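{- There exists a deterministic online algorithm for the online fractional knapsack problem in the random order model that is $4.39$-competitive. That is, there are a deterministic online algorithm $\mathcal{A}$ and a sequence $\varepsilon_n \to 0$ such that for every $n \ge 1$ and every instance $\mathcal{I}$ with $n$ items, $$\mathbb{E}[\mathcal{A}(\mathcal{I})] \ge \left(\frac{1}{4.39} - \varepsilon_n\right)\cdot \operatorname{OPT}(\mathcal{I}),$$ where the expectation is over the uniformly random arrival order of the items.
   Context: Fractional knapsack: an instance $\mathcal{I}$ consists of a set $I$ of $n$ items, where item $i \in I$ has size $s_i \in \mathbb{Q}_{>0}$ and profit $v_i \in \mathbb{Q}_{\ge 0}$, and a knapsack capacity $W \in \mathbb{Q}_{>0}$. A feasible fractional packing is a vector $x \in \mathbb{Q}^n$ with $0 \le x_i \le 1$ for all $i$ and $\sum_{i \in I} s_i x_i \le W$; its profit is $\sum_{i\in I} v_i x_i$. $\operatorname{OPT}(\mathcal{I})$ denotes the maximum profit of a feasible fractional packing. Online problem in the random order model: an adversary fixes the instance; then a permutation of the items is chosen uniformly at random and determines the arrival order. The algorithm knows $n$ and $W$ in advance. In round $\ell \in \{1,\dots,n\}$ the item arriving in that round is revealed with its size and profit (items carry distinct identifiers, which may be used for consistent tie-breaking between items of equal value), and the algorithm must immediately and irrevocably fix the fraction of this item in the final packing, based only on the items revealed so far (and $n$, $W$). The resulting packing must be feasible for every arrival order. A deterministic algorithm uses no randomness of its own. $\mathcal{A}(\mathcal{I})$ is the profit of the final packing. Competitive ratio: $\mathcal{A}$ is $r$-competitive if $\mathbb{E}[\mathcal{A}(\mathcal{I})]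 \ge (1/r - o(1))\operatorname{OPT}(\mathcal{I})$ for all instances $\mathcal{I}$, where the $o(1)$ term vanishes asymptotically with respect to the number $n$ of items. -}

module Defs where

open import Algebra.Bundles using (CommutativeRing)
import Algebra.Properties.Semiring.Sum as SemiringSum
open import Data.Fin.Base using (Fin; zero; suc; toℕ; punchIn; punchOut)
open import Data.Fin.Properties using (punchIn-punchOut) renaming (_≟_ to _≟ᶠ_)
open import Data.Fin.Permutation
  using (Permutation′; _⟨$⟩ʳ_; _⟨$⟩ˡ_; insert; remove; insert-remove)
  renaming (id to idₚ; _≈_ to _≈ₚ_)
import Data.Integer.Base as ℤ
open import Data.List.Base as List
  using (List; _∷_; []; length; map; cartesianProductWith; allFin)
open import Data.List.Properties using (length-++; length-map; length-tabulate)
open import Data.List.Membership.Propositional.Properties using (∈-allFin)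
open import Data.List.Relation.Unary.Any using (Any; here)
import Data.List.Relation.Unary.Any.Properties as Any
open import Data.Nat.Base as ℕ using (ℕ; zero; suc; _!)
import Data.Nat.Properties as ℕ
open import Data.Product.Base using (Σ-syntax; _×_; _,_; proj₁; proj₂)
open import Data.Rational.Base
  using (ℚ; 0ℚ; 1ℚ; _+_; _*_; _-_; -_; _/_; _÷_; 1/_; ∣_∣; _≤_; _<_; NonZero
        ; positive; nonNegative)
open import Data.Rational.Properties hiding (_≟_)
open import Data.Rational.Solver using (module +-*-Solver)
open import Data.Sum.Base using (inj₁; inj₂)
open import Data.Vec.Functional as Vector using (Vector; replicate; insertAt; removeAt)
open import Data.Vec.Functional.Properties using (insertAt-lookup; insertAt-punchIn)
open import Function.Base using (_∘_)
open import Function.Definitions using (Injective)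
open import Relation.Binary.PropositionalEquality
open import Relation.Nullary using (yes; no)

open +-*-Solver using (solve; _:+_; _:*_; _:-_; _:=_)
open SemiringSum (CommutativeRing.semiring +-*-commutativeRing)
  using (sum; sum-cong-≗; sum-remove; ∑-distrib-+; *-distribˡ-sum)

------------------------------------------------------------------------
-- Fractional knapsack

record Item : Set where
  field
    ident    : ℕ
    size     : ℚ
    profit   : ℚ
    0<size   : 0ℚ < size
    0≤profit : 0ℚ ≤ profit

open Item public

record Instance (n : ℕ) : Set where
  field
    capacity        : ℚ
    0<capacity      : 0ℚ < capacity
    item            : Vector Item n
    ident-injective : Injective _≡_ _≡_ (ident ∘ item)

open Instance public

totalSize : ∀ {n} → Instance n → Vector ℚ n → ℚ
totalSize I x = sum (λ i → size (item I i) * x i)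

totalProfit : ∀ {n} → Instance n → Vector ℚ n → ℚ
totalProfit I x = sum (λ i → profit (item I i) * x i)

record Feasible {n} (I : Instance n) (x : Vector ℚ n) : Set where
  field
    nonNeg  : ∀ i → 0ℚ ≤ x i
    atMost1 : ∀ i → x i ≤ 1ℚ
    fits    : totalSize I x ≤ capacity I

open Feasible public

Optimal : ∀ {n} → Instance n → Vector ℚ n → Set
Optimal I x = Feasible I x × (∀ y → Feasible I y → totalProfit I y ≤ totalProfit I x)

------------------------------------------------------------------------
-- The maximum profit is attained

private

  ∑-mono : ∀ {n} {f g : Vector ℚ n} → (∀ i → f i ≤ g i) → sum f ≤ sum g
  ∑-mono {zero}  f≤g = ≤-refl
  ∑-mono {suc n} f≤g = +-mono-≤ (f≤g zero) (∑-mono (f≤g ∘ suc))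

  punchIn-cases : ∀ {n} (P : Fin (suc n) → Set) j →
                  P j → (∀ k → P (punchIn j k)) → ∀ i → P i
  punchIn-cases P j Pj Pk i with j ≟ᶠ i
  ... | yes refl = Pj
  ... | no  j≢i  = subst P (punchIn-punchOut j≢i) (Pk (punchOut j≢i))

  argmax : ∀ {n} (d : Vector ℚ (suc n)) → Σ[ j ∈ Fin (suc n) ] (∀ i → d i ≤ d j)
  argmax {zero}  d = zero , λ { zero → ≤-refl }
  argmax {suc n} d with argmax (d ∘ suc)
  ... | j , max with ≤-total (d zero) (d (suc j))
  ...   | inj₁ d₀≤dⱼ = suc j , λ { zero → d₀≤dⱼ ; (suc i) → max i }
  ...   | inj₂ dⱼ≤d₀ = zero  , λ { zero → ≤-refl ; (suc i) → ≤-trans (max i) dⱼ≤d₀ }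

  exchange : ∀ {d t y z} → t ≤ d → y ≤ z → d * y + t * z ≤ d * z + t * y
  exchange {d} {t} {y} {z} t≤d y≤z = begin
    d * y + t * z                            ≡⟨ +-identityʳ _ ⟨
    d * y + t * z + 0ℚ                       ≡⟨ cong (d * y + t * z +_) (*-zeroʳ (d - t)) ⟨
    d * y + t * z + (d - t) * 0ℚ             ≤⟨ +-monoʳ-≤ (d * y + t * z)
                                                  (*-monoˡ-≤-nonNeg (d - t) {{nonNegative 0≤d-t}} 0≤z-y) ⟩
    d * y + t * z + (d - t) * (z - y)        ≡⟨ solve 4 (λ a b u v →
                                                  a :* u :+ b :* v :+ (a :- b) :* (v :- u)
                                                  := a :* v :+ b :* u) refl d t y z ⟩
    d * z + t * y                            ∎
    where
    open ≤-Reasoning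
    diff : ∀ {p q} → p ≤ q → 0ℚ ≤ q - p
    diff {p} {q} p≤q = subst (_≤ q - p) (+-inverseʳ p) (+-monoˡ-≤ (- p) p≤q)
    0≤d-t : 0ℚ ≤ d - t
    0≤d-t = diff t≤d
    0≤z-y : 0ℚ ≤ z - y
    0≤z-y = diff y≤z

  -- Packed amounts z i = s i * x i for item densities d, with a dual
  -- solution t certifying optimality by complementary slackness.
  record Certificate {n} (s d : Vector ℚ n) (W : ℚ) : Set where
    field
      z      : Vector ℚ n
      t      : ℚ
      0≤z    : ∀ i → 0ℚ ≤ z i
      z≤s    : ∀ i → z i ≤ s i
      z-fits : sum z ≤ W
      0≤t    : 0ℚ ≤ t
      t≤     : ∀ b → 0ℚ ≤ b → (∀ i → d i ≤ b) → t ≤ b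
      slack  : ∀ i y → 0ℚ ≤ y → y ≤ s i → d i * y + t * z i ≤ d i * z i + t * y
      tight  : t * W ≤ t * sum z

  sum-insertAt : ∀ {n} (z : Vector ℚ n) j a → sum (insertAt z j a) ≡ a + sum z
  sum-insertAt z j a = trans (sum-remove {i = j} (insertAt z j a))
    (cong₂ _+_ (insertAt-lookup z j a) (sum-cong-≗ (insertAt-punchIn z j a)))

  sum-0 : ∀ n → sum (replicate n 0ℚ) ≡ 0ℚ
  sum-0 zero    = refl
  sum-0 (suc n) = trans (+-identityˡ _) (sum-0 n)

  certificate : ∀ {n} (s d : Vector ℚ n) W → (∀ i → 0ℚ ≤ s i) → (∀ i → 0ℚ ≤ d i) →
                0ℚ ≤ W → Certificate s d W
  certificate {zero} s d W 0≤s 0≤d 0≤W = record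
    { z = Vector.[] ; t = 0ℚ
    ; 0≤z = λ () ; z≤s = λ () ; z-fits = 0≤W
    ; 0≤t = ≤-refl ; t≤ = λ _ 0≤b _ → 0≤b
    ; slack = λ ()
    ; tight = ≤-reflexive (*-zeroˡ W)
    }
  certificate {suc n} s d W 0≤s 0≤d 0≤W with argmax d
  ... | j , max with ≤-total W (s j)
  ...   | inj₁ W≤sⱼ = record
    { z = ζ ; t = d j
    ; 0≤z = punchIn-cases (λ i → 0ℚ ≤ ζ i) j
              (≤-trans 0≤W (≤-reflexive (sym ζⱼ))) (λ k → ≤-reflexive (sym (ζₖ k)))
    ; z≤s = punchIn-cases (λ i → ζ i ≤ s i) j
              (≤-trans (≤-reflexive ζⱼ) W≤sⱼ) (λ k → ≤-trans (≤-reflexive (ζₖ k)) (0≤s _))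
    ; z-fits = ≤-reflexive sum-ζ
    ; 0≤t = 0≤d j ; t≤ = λ _ _ d≤b → d≤b j
    ; slack = punchIn-cases
        (λ i → ∀ y → 0ℚ ≤ y → y ≤ s i → d i * y + d j * ζ i ≤ d i * ζ i + d j * y) j
        (λ y _ _ → ≤-reflexive (+-comm (d j * y) (d j * ζ j)))
        (λ k y 0≤y _ → subst₂ _≤_ (+-comm (d j * ζ (punchIn j k)) _) (+-comm (d j * y) _)
          (exchange (max (punchIn j k)) (≤-trans (≤-reflexive (ζₖ k)) 0≤y)))
    ; tight = ≤-reflexive (cong (d j *_) (sym sum-ζ))
    }
    where
    ζ : Vector ℚ (suc n)
    ζ = insertAt (replicate n 0ℚ) j W
    ζⱼ : ζ j ≡ W
    ζⱼ = insertAt-lookup (replicate n 0ℚ) j W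
    ζₖ : ∀ k → ζ (punchIn j k) ≡ 0ℚ
    ζₖ = insertAt-punchIn (replicate n 0ℚ) j W
    sum-ζ : sum ζ ≡ W
    sum-ζ = trans (sum-insertAt (replicate n 0ℚ) j W)
              (trans (cong (W +_) (sum-0 n)) (+-identityʳ W))
  ...   | inj₂ sⱼ≤W = record
    { z = ζ ; t = C.t
    ; 0≤z = punchIn-cases (λ i → 0ℚ ≤ ζ i) j
              (≤-trans (0≤s j) (≤-reflexive (sym ζⱼ)))
              (λ k → ≤-trans (C.0≤z k) (≤-reflexive (sym (ζₖ k))))
    ; z≤s = punchIn-cases (λ i → ζ i ≤ s i) j
              (≤-reflexive ζⱼ) (λ k → ≤-trans (≤-reflexive (ζₖ k)) (C.z≤s k))
    ; z-fits = ≤-trans (≤-reflexive sum-ζ)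
                 (≤-trans (+-monoʳ-≤ (s j) C.z-fits) (≤-reflexive sⱼ+[W-sⱼ]))
    ; 0≤t = C.0≤t ; t≤ = λ b 0≤b d≤b → C.t≤ b 0≤b (d≤b ∘ punchIn j)
    ; slack = punchIn-cases
        (λ i → ∀ y → 0ℚ ≤ y → y ≤ s i → d i * y + C.t * ζ i ≤ d i * ζ i + C.t * y) j
        (λ y _ y≤sⱼ → exchange (C.t≤ (d j) (0≤d j) (max ∘ punchIn j))
                        (≤-trans y≤sⱼ (≤-reflexive (sym ζⱼ))))
        (λ k y 0≤y y≤s → subst
          (λ a → d (punchIn j k) * y + C.t * a ≤ d (punchIn j k) * a + C.t * y)
          (sym (ζₖ k)) (C.slack k y 0≤y y≤s))
    ; tight = begin
        C.t * W                           ≡⟨ cong (C.t *_) sⱼ+[W-sⱼ] ⟨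
        C.t * (s j + (W - s j))           ≡⟨ *-distribˡ-+ C.t (s j) (W - s j) ⟩
        C.t * s j + C.t * (W - s j)       ≤⟨ +-monoʳ-≤ (C.t * s j) C.tight ⟩
        C.t * s j + C.t * sum C.z         ≡⟨ *-distribˡ-+ C.t (s j) (sum C.z) ⟨
        C.t * (s j + sum C.z)             ≡⟨ cong (C.t *_) sum-ζ ⟨
        C.t * sum ζ                       ∎
    }
    where
    open ≤-Reasoning
    0≤W-sⱼ : 0ℚ ≤ W - s j
    0≤W-sⱼ = subst (_≤ W - s j) (+-inverseʳ (s j)) (+-monoˡ-≤ (- s j) sⱼ≤W)
    module C = Certificate (certificate (removeAt s j) (removeAt d j) (W - s j)
                 (0≤s ∘ punchIn j) (0≤d ∘ punchIn j) 0≤W-sⱼ)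
    sⱼ+[W-sⱼ] : s j + (W - s j) ≡ W
    sⱼ+[W-sⱼ] = solve 2 (λ a b → a :+ (b :- a) := b) refl (s j) W
    ζ : Vector ℚ (suc n)
    ζ = insertAt C.z j (s j)
    ζⱼ : ζ j ≡ s j
    ζⱼ = insertAt-lookup C.z j (s j)
    ζₖ : ∀ k → ζ (punchIn j k) ≡ C.z k
    ζₖ = insertAt-punchIn C.z j (s j)
    sum-ζ : sum ζ ≡ s j + sum C.z
    sum-ζ = sum-insertAt C.z j (s j)

  certificate-optimal : ∀ {n} {s d : Vector ℚ n} {W} (C : Certificate s d W) →
    ∀ y → (∀ i → 0ℚ ≤ y i) → (∀ i → y i ≤ s i) → sum y ≤ W →
    sum (λ i → d i * y i) ≤ sum (λ i → d i * Certificate.z C i)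
  certificate-optimal {s = s} {d} {W} C y 0≤y y≤s y-fits =
    +-cancelʳ-≤ (t * sum z) (begin
      sum (λ i → d i * y i) + t * sum z                ≡⟨ cong (sum (λ i → d i * y i) +_) (*-distribˡ-sum t z) ⟩
      sum (λ i → d i * y i) + sum (λ i → t * z i)      ≡⟨ ∑-distrib-+ (λ i → d i * y i) (λ i → t * z i) ⟨
      sum (λ i → d i * y i + t * z i)                  ≤⟨ ∑-mono (λ i → slack i (y i) (0≤y i) (y≤s i)) ⟩
      sum (λ i → d i * z i + t * y i)                  ≡⟨ ∑-distrib-+ (λ i → d i * z i) (λ i → t * y i) ⟩
      sum (λ i → d i * z i) + sum (λ i → t * y i)      ≡⟨ cong (sum (λ i → d i * z i) +_) (*-distribˡ-sum t y) ⟨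
      sum (λ i → d i * z i) + t * sum y                ≤⟨ +-monoʳ-≤ (sum (λ i → d i * z i))
                                                            (*-monoˡ-≤-nonNeg t {{nonNegative 0≤t}} y-fits) ⟩
      sum (λ i → d i * z i) + t * W                    ≤⟨ +-monoʳ-≤ (sum (λ i → d i * z i)) tight ⟩
      sum (λ i → d i * z i) + t * sum z                ∎)
    where
    open Certificate C
    open ≤-Reasoning
    +-cancelʳ-≤ : ∀ r {p q} → p + r ≤ q + r → p ≤ q
    +-cancelʳ-≤ r {p} {q} p+r≤q+r =
      subst₂ _≤_ (cancel p) (cancel q) (+-monoˡ-≤ (- r) p+r≤q+r)
      where
      cancel : ∀ p → p + r - r ≡ p
      cancel p = solve 2 (λ a b → a :+ b :- b := a) refl p r

optimal-exists : ∀ {n} (I : Instance n) → Σ[ x ∈ Vector ℚ n ] Optimal I x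
optimal-exists {n} I = x , feasible , optimal
  where
  s v d : Vector ℚ n
  s i = size (item I i)
  v i = profit (item I i)
  instance
    s≢0 : ∀ {i} → NonZero (s i)
    s≢0 {i} = pos⇒nonZero (s i) {{positive (0<size (item I i))}}
  0<s : ∀ i → 0ℚ < s i
  0<s i = 0<size (item I i)
  0≤÷s : ∀ i {a} → 0ℚ ≤ a → 0ℚ ≤ a ÷ s i
  0≤÷s i {a} 0≤a = subst (_≤ a ÷ s i) (*-zeroˡ (1/ s i))
    (*-monoʳ-≤-nonNeg (1/ s i)
      {{pos⇒nonNeg (1/ s i) {{1/pos⇒pos (s i) {{positive (0<s i)}}}}}} 0≤a)
  s*[÷s] : ∀ i a → s i * (a ÷ s i) ≡ a
  s*[÷s] i a = trans (solve 3 (λ p q r → p :* (q :* r) := q :* (p :* r)) refl (s i) a (1/ s i))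
                 (trans (cong (a *_) (*-inverseʳ (s i))) (*-identityʳ a))
  d i = v i ÷ s i
  C : Certificate s d (capacity I)
  C = certificate s d (capacity I) (<⇒≤ ∘ 0<s) (λ i → 0≤÷s i (0≤profit (item I i)))
        (<⇒≤ (0<capacity I))
  open Certificate C
  x : Vector ℚ n
  x i = z i ÷ s i
  v*≡d*s* : ∀ i a → v i * a ≡ d i * (s i * a)
  v*≡d*s* i a = trans (cong (_* a) (sym (s*[÷s] i (v i))))
    (solve 3 (λ p q r → p :* q :* r := q :* (p :* r)) refl (s i) (d i) a)
  feasible : Feasible I x
  feasible = record
    { nonNeg  = λ i → 0≤÷s i (0≤z i)
    ; atMost1 = λ i → *-cancelˡ-≤-pos (s i) {{positive (0<s i)}}
        (subst₂ _≤_ (sym (s*[÷s] i (z i))) (sym (*-identityʳ (s i))) (z≤s i))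
    ; fits    = ≤-trans (≤-reflexive (sum-cong-≗ (λ i → s*[÷s] i (z i)))) z-fits
    }
  optimal : ∀ y → Feasible I y → totalProfit I y ≤ totalProfit I x
  optimal y F = subst₂ _≤_
    (sum-cong-≗ (λ i → sym (v*≡d*s* i (y i))))
    (sum-cong-≗ (λ i → sym (trans (v*≡d*s* i (x i)) (cong (d i *_) (s*[÷s] i (z i))))))
    (certificate-optimal C (λ i → s i * y i)
      (λ i → subst (_≤ s i * y i) (*-zeroʳ (s i)) (s*-mono i (nonNeg F i)))
      (λ i → ≤-trans (s*-mono i (atMost1 F i)) (≤-reflexive (*-identityʳ (s i))))
      (fits F))
    where
    s*-mono : ∀ i {a b} → a ≤ b → s i * a ≤ s i * b
    s*-mono i = *-monoˡ-≤-nonNeg (s i) {{nonNegative (<⇒≤ (0<s i))}}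

OPT : ∀ {n} → Instance n → ℚ
OPT I = totalProfit I (proj₁ (optimal-exists I))

------------------------------------------------------------------------
-- Uniformly random permutations

permutations : ∀ n → List (Permutation′ n)
permutations zero    = idₚ ∷ []
permutations (suc n) = cartesianProductWith (insert zero) (allFin (suc n)) (permutations n)

-- Every permutation occurs, and there are n ! entries, hence each
-- permutation occurs exactly once.

permutations-complete : ∀ {n} (σ : Permutation′ n) → Any (σ ≈ₚ_) (permutations n)
permutations-complete {zero}  σ = here (λ ())
permutations-complete {suc n} σ =
  Any.cartesianProductWith⁺ (insert zero)
    (λ { {_} {ρ} refl rest i → trans (sym (insert-remove zero σ i)) (insert-cong rest i) })
    (∈-allFin (σ ⟨$⟩ʳ zero))
    (permutations-complete (remove zero σ))
  where
  insert-cong : ∀ {j} {π ρ : Permutation′ n} → π ≈ₚ ρ → insert zero j π ≈ₚ insert zero j ρ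
  insert-cong π≈ρ zero    = refl
  insert-cong π≈ρ (suc i) = cong (punchIn _) (π≈ρ i)

length-permutations : ∀ n → length (permutations n) ≡ n !
length-permutations zero    = refl
length-permutations (suc n) = trans
  (length-product (allFin (suc n)) (permutations n))
  (cong₂ ℕ._*_ (length-tabulate {n = suc n} (λ i → i)) (length-permutations n))
  where
  length-product : ∀ {A B C : Set} {f : A → B → C} xs ys →
    length (cartesianProductWith f xs ys) ≡ length xs ℕ.* length ys
  length-product         []       ys = refl
  length-product {f = f} (x ∷ xs) ys = trans
    (length-++ (map (f x) ys))
    (cong₂ ℕ._+_ (length-map (f x) ys) (length-product xs ys))

𝔼 : ∀ {n} → (Permutation′ n → ℚ) → ℚ
𝔼 {n} f = ((ℤ.+ 1) / (n !)) {{n ℕ.!≢0}} * List.foldr _+_ 0ℚ (map f (permutations n))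

------------------------------------------------------------------------
-- Online algorithms in the random order model

-- In arrival order σ, item σ ⟨$⟩ʳ ℓ arrives in round ℓ (counting from 0).
-- The result lists the items of rounds 0, …, ℓ; the last entry is the
-- item to be decided on in round ℓ.
revealed : ∀ {n} → Instance n → Permutation′ n → Fin n → List Item
revealed I σ ℓ = List.take (suc (toℕ ℓ)) (List.tabulate (λ k → item I (σ ⟨$⟩ʳ k)))

-- The arguments are the number of items, the capacity and the revealed
-- items; earlier decisions can be recomputed from these.
Rule : Set
Rule = ℕ → ℚ → List Item → ℚ

packing : Rule → ∀ {n} → Instance n → Permutation′ n → Vector ℚ n
packing A {n} I σ i = A n (capacity I) (revealed I σ (σ ⟨$⟩ˡ i))

record OnlineAlgorithm : Set where
  field
    rule     : Rule
    feasible : ∀ {n} (I : Instance n) (σ : Permutation′ n) → Feasible I (packing rule I σ)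

open OnlineAlgorithm public

expectedProfit : OnlineAlgorithm → ∀ {n} → Instance n → ℚ
expectedProfit A I = 𝔼 (λ σ → totalProfit I (packing (rule A) I σ))

------------------------------------------------------------------------
-- Competitiveness

_⟶0 : (ℕ → ℚ) → Set
ε ⟶0 = ∀ δ → 0ℚ < δ → Σ[ N ∈ ℕ ] (∀ n → N ℕ.≤ n → ∣ ε n ∣ < δ)

Competitive : (r : ℚ) .{{_ : NonZero r}} → OnlineAlgorithm → Set
Competitive r A = Σ[ ε ∈ (ℕ → ℚ) ] (ε ⟶0) ×
  (∀ n → 1 ℕ.≤ n → (I : Instance n) → (1/ r - ε n) * OPT I ≤ expectedProfit A I)

{-# OPTIONS --safe #-}

-- The first m = ⌊n/2⌋ items are only observed. In every later round the
-- newest item a receives the fraction x a of an optimal packing of the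
-- revealed items, scaled by R, the part of the capacity still free; if the
-- optimal packing assigns capacity z to a, then R shrinks by 1 - z/W.
-- Given the set of the first k revealed items, the newest one is uniform
-- among them and the order of the others is irrelevant for x. Hence R
-- shrinks in round k by a factor of expectation at least 1 - 1/k, so
-- 𝔼 R ≥ m/k ≥ m/n by telescoping, and each of the n - m later rounds earns
-- at least OPT/n · m/n. In total this is about OPT/4, which suffices
-- because 4 < 4.39.

module Submission where

open import Defs
open import Algebra.Bundles using (CommutativeRing)
import Algebra.Properties.Semiring.Mult as Mult
import Algebra.Properties.Semiring.Sum as SemiringSum
open import Data.Bool.Base using (true; false; if_then_else_)
open import Data.Fin.Base using (zero; suc; toℕ)
open import Data.Fin.Permutation using (Permutation′; _⟨$⟩ʳ_; _⟨$⟩ˡ_; insert; inverseˡ)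
open import Data.Fin.Properties using (any?)
import Data.Integer.Base as ℤ
open import Data.Integer.Base using (+_)
import Data.Integer.Properties as ℤ
open import Data.List.Base
  using (List; []; _∷_; _++_; _∷ʳ_; _ʳ++_; length; map; foldr; tabulate; take; reverse
        ; cartesianProductWith; allFin)
open import Data.List.Properties
  using (∷ʳ-++; map-cong; map-∘; map-tabulate; length-tabulate; ++-identityʳ)
open import Data.List.Relation.Binary.Permutation.Propositional
  using (_↭_; refl; prep; swap; trans; ↭-sym; ↭⇒↭ₛ)
open import Data.List.Relation.Binary.Permutation.Propositional.Properties
  using (↭-length; All-resp-↭; map⁺)
import Data.List.Relation.Binary.Permutation.Setoid.Properties as Permutationₛ
open import Data.List.Relation.Unary.All as All using (All; []; _∷_)
import Data.List.Relation.Unary.All.Properties as All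
open import Data.List.Relation.Unary.AllPairs using (AllPairs; []; _∷_)
open import Data.List.Relation.Unary.Sorted.TotalOrder.Properties using (Sorted⇒AllPairs)
open import Data.List.Relation.Unary.Unique.Propositional using (Unique)
open import Data.List.Relation.Unary.Unique.Propositional.Properties using (tabulate⁺)
open import Data.List.Sort using (sort; sort-↭; sort-↗)
open import Data.Nat.Base as ℕ using (ℕ; zero; suc; _!; _∸_; _<ᵇ_; ⌊_/2⌋; ⌈_/2⌉)
import Data.Nat.Properties as ℕ
open import Data.Nat.Solver using () renaming (module +-*-Solver to ℕSolver)
open import Data.Product.Base using (Σ-syntax; _,_; proj₁; proj₂)
open import Data.Product.Relation.Binary.Lex.NonStrict using (×-decTotalOrder)
open import Data.Rational.Base
  using (ℚ; 0ℚ; 1ℚ; _+_; _*_; _-_; -_; _/_; 1/_; ∣_∣; _⊓_; _≤_; _<_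
        ; NonZero; Positive; positive; nonNegative; toℚᵘ)
open import Data.Rational.Properties
open import Data.Rational.Solver using (module +-*-Solver)
import Data.Rational.Unnormalised.Base as ℚᵘ
import Data.Rational.Unnormalised.Properties as ℚᵘ
open import Data.Sum.Base as Sum using (_⊎_; inj₁; inj₂)
open import Data.Vec.Functional using (Vector; removeAt)
open import Function.Base using (_∘_)
open import Relation.Binary.Bundles using (DecTotalOrder)
import Relation.Binary.Construct.On as On
open import Relation.Binary.PropositionalEquality as ≡
  using (_≡_; refl; sym; cong; cong₂; subst; subst₂; module ≡-Reasoning)
open import Relation.Nullary using (¬_; yes; no; does; contradiction)
open import Relation.Nullary.Decidable using (dec-true; dec-false)

open +-*-Solver using (solve; _:+_; _:*_; _:-_; _:=_; con)
open ℕSolver using () renaming (_:+_ to _⊕_; _:*_ to _⊗_; _:=_ to _⊜_; con to ‵_)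
open Mult (CommutativeRing.semiring +-*-commutativeRing)
  using () renaming (_×_ to _·_; ×-homo-+ to ·-homo-+; ×1-homo-* to ·1-homo-*)
open SemiringSum (CommutativeRing.semiring +-*-commutativeRing)
  using (sum; sum-cong-≗; sum-permute)

private variable
  A B C : Set
  xs ys : List A
  k n   : ℕ

-- Order and finite sums of rationals

0≤* : ∀ {p q} → 0ℚ ≤ p → 0ℚ ≤ q → 0ℚ ≤ p * q
0≤* {p} {q} 0≤p 0≤q = subst (_≤ p * q) (*-zeroʳ p) (*-monoˡ-≤-nonNeg p {{nonNegative 0≤p}} 0≤q)

0≤+ : ∀ {p q} → 0ℚ ≤ p → 0ℚ ≤ q → 0ℚ ≤ p + q
0≤+ = +-mono-≤

p≤q⇒0≤q-p : ∀ {p q} → p ≤ q → 0ℚ ≤ q - p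
p≤q⇒0≤q-p {p} {q} p≤q = subst (_≤ q - p) (+-inverseʳ p) (+-monoˡ-≤ (- p) p≤q)

0≤q-p⇒p≤q : ∀ {p q} → 0ℚ ≤ q - p → p ≤ q
0≤q-p⇒p≤q {p} {q} 0≤ = subst₂ _≤_ (+-identityˡ p) (solve 2 (λ p q → q :- p :+ p := q) refl p q)
  (+-monoˡ-≤ p 0≤)

-- A multiple of `1ℚ`, so that the homomorphism laws of `_·_` apply and `ι (suc k)` unfolds to
-- `1ℚ + ι k`.
ι : ℕ → ℚ
ι k = k · 1ℚ

0≤ι : ∀ k → 0ℚ ≤ ι k
0≤ι zero    = ≤-refl
0≤ι (suc k) = 0≤+ {1ℚ} {ι k} (nonNegative⁻¹ 1ℚ) (0≤ι k)

ι-mono : ∀ {j k} → j ℕ.≤ k → ι j ≤ ι k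
ι-mono {k = k} ℕ.z≤n = 0≤ι k
ι-mono (ℕ.s≤s j≤k)   = +-monoʳ-≤ 1ℚ (ι-mono j≤k)

0≤sum : ∀ {n} {f : Vector ℚ n} → (∀ i → 0ℚ ≤ f i) → 0ℚ ≤ sum f
0≤sum {zero}  0≤f = ≤-refl
0≤sum {suc n} 0≤f = 0≤+ (0≤f zero) (0≤sum (0≤f ∘ suc))

∑ₗ : (A → ℚ) → List A → ℚ
∑ₗ f = foldr _+_ 0ℚ ∘ map f

∑ₗ-++ : ∀ (f : A → ℚ) xs ys → ∑ₗ f (xs ++ ys) ≡ ∑ₗ f xs + ∑ₗ f ys
∑ₗ-++ f []       ys = sym (+-identityˡ _)
∑ₗ-++ f (x ∷ xs) ys = ≡.trans (cong (λ s → f x + s) (∑ₗ-++ f xs ys)) (sym (+-assoc (f x) _ _))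

∑ₗ-nonNeg : ∀ {f : A → ℚ} → (∀ x → 0ℚ ≤ f x) → ∀ xs → 0ℚ ≤ ∑ₗ f xs
∑ₗ-nonNeg 0≤f []       = ≤-refl
∑ₗ-nonNeg 0≤f (x ∷ xs) = 0≤+ (0≤f x) (∑ₗ-nonNeg 0≤f xs)

∑ₗ-mono : ∀ {f g : A → ℚ} → (∀ x → f x ≤ g x) → ∀ xs → ∑ₗ f xs ≤ ∑ₗ g xs
∑ₗ-mono f≤g []       = ≤-refl
∑ₗ-mono f≤g (x ∷ xs) = +-mono-≤ (f≤g x) (∑ₗ-mono f≤g xs)

∑ₗ-↭ : ∀ (f : A → ℚ) → xs ↭ ys → ∑ₗ f xs ≡ ∑ₗ f ys
∑ₗ-↭ f refl         = refl
∑ₗ-↭ f (prep x p)   = cong (λ s → f x + s) (∑ₗ-↭ f p)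
∑ₗ-↭ f (swap x y p) = ≡.trans (cong (λ s → f x + (f y + s)) (∑ₗ-↭ f p))
  (solve 3 (λ a b c → a :+ (b :+ c) := b :+ (a :+ c)) refl (f x) (f y) _)
∑ₗ-↭ f (trans p q)  = ≡.trans (∑ₗ-↭ f p) (∑ₗ-↭ f q)

∑ₗ-cartesianProductWith : ∀ (f : C → ℚ) (g : A → B → C) xs ys →
  ∑ₗ f (cartesianProductWith g xs ys) ≡ ∑ₗ (λ x → ∑ₗ (λ y → f (g x y)) ys) xs
∑ₗ-cartesianProductWith f g []       ys = refl
∑ₗ-cartesianProductWith f g (x ∷ xs) ys = ≡.trans (∑ₗ-++ f (map (g x) ys) _)
  (cong₂ _+_ (cong (foldr _+_ 0ℚ) (sym (map-∘ ys))) (∑ₗ-cartesianProductWith f g xs ys))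

∑ₗ-tabulate : ∀ (f : A → ℚ) (a : Vector A n) → ∑ₗ f (tabulate a) ≡ sum (f ∘ a)
∑ₗ-tabulate {n = zero}  f a = refl
∑ₗ-tabulate {n = suc n} f a = cong (λ s → f (a zero) + s) (∑ₗ-tabulate f (a ∘ suc))

-- Sums over the choice of one entry

-- The sum of h x (xs without x) over the entries x of xs, by position.
∑pick : (A → List A → ℚ) → List A → ℚ
∑pick h []       = 0ℚ
∑pick h (x ∷ xs) = h x xs + ∑pick (λ a ys → h a (x ∷ ys)) xs

-- The pointwise bound may assume `a ∷ ys ↭ xs`, from which later inductions recover the length and
-- the distinctness of `ys`.
∑pick-mono : ∀ {f g : A → List A → ℚ} xs → (∀ a ys → a ∷ ys ↭ xs → f a ys ≤ g a ys) →
             ∑pick f xs ≤ ∑pick g xs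
∑pick-mono []       f≤g = ≤-refl
∑pick-mono (x ∷ xs) f≤g = +-mono-≤ (f≤g x xs refl)
  (∑pick-mono xs (λ a ys p → f≤g a (x ∷ ys) (trans (swap a x refl) (prep x p))))

∑pick-cong : ∀ {f g : A → List A → ℚ} xs → (∀ a ys → a ∷ ys ↭ xs → f a ys ≡ g a ys) →
             ∑pick f xs ≡ ∑pick g xs
∑pick-cong xs f≡g = ≤-antisym (∑pick-mono xs (λ a ys p → ≤-reflexive (f≡g a ys p)))
                              (∑pick-mono xs (λ a ys p → ≤-reflexive (sym (f≡g a ys p))))

∑pick-+ : ∀ (f g : A → List A → ℚ) xs →
          ∑pick (λ a ys → f a ys + g a ys) xs ≡ ∑pick f xs + ∑pick g xs
∑pick-+ f g []       = refl
∑pick-+ f g (x ∷ xs) = ≡.trans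
  (cong (λ s → f x xs + g x xs + s) (∑pick-+ (λ a ys → f a (x ∷ ys)) (λ a ys → g a (x ∷ ys)) xs))
  (solve 4 (λ a b c d → a :+ b :+ (c :+ d) := a :+ c :+ (b :+ d)) refl (f x xs) (g x xs) _ _)

∑pick-* : ∀ c (f : A → List A → ℚ) xs → ∑pick (λ a ys → c * f a ys) xs ≡ c * ∑pick f xs
∑pick-* c f []       = sym (*-zeroʳ c)
∑pick-* c f (x ∷ xs) = ≡.trans (cong (λ s → c * f x xs + s) (∑pick-* c (λ a ys → f a (x ∷ ys)) xs))
  (sym (*-distribˡ-+ c _ _))

∑pick-const : ∀ c (xs : List A) → ∑pick (λ _ _ → c) xs ≡ ι (length xs) * c
∑pick-const c []       = sym (*-zeroˡ c)
∑pick-const c (x ∷ xs) = ≡.trans (cong (λ s → c + s) (∑pick-const c xs))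
  (solve 2 (λ c l → c :+ l :* c := (con 1ℚ :+ l) :* c) refl c (ι (length xs)))

∑pick-entry : ∀ (f : A → ℚ) xs → ∑pick (λ a _ → f a) xs ≡ ∑ₗ f xs
∑pick-entry f []       = refl
∑pick-entry f (x ∷ xs) = cong (λ s → f x + s) (∑pick-entry f xs)

-- Each entry is missing from exactly one of the `suc k` rests. Adding the picked entry back makes
-- every summand equal to `∑ₗ f xs`.
∑pick-rest : ∀ (f : A → ℚ) xs → length xs ≡ suc k →
             ∑pick (λ _ ys → ∑ₗ f ys) xs ≡ ι k * ∑ₗ f xs
∑pick-rest {k = k} f xs len = begin
  ∑pick (λ _ ys → ∑ₗ f ys) xs
    ≡⟨ solve 2 (λ p q → p := q :+ p :- q) refl _ (∑ₗ f xs) ⟩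
  ∑ₗ f xs + ∑pick (λ _ ys → ∑ₗ f ys) xs - ∑ₗ f xs
    ≡⟨ cong (λ s → s + ∑pick (λ _ ys → ∑ₗ f ys) xs - ∑ₗ f xs) (∑pick-entry f xs) ⟨
  ∑pick (λ a _ → f a) xs + ∑pick (λ _ ys → ∑ₗ f ys) xs - ∑ₗ f xs
    ≡⟨ cong (_- ∑ₗ f xs) (∑pick-+ (λ a _ → f a) (λ _ ys → ∑ₗ f ys) xs) ⟨
  ∑pick (λ a ys → f a + ∑ₗ f ys) xs - ∑ₗ f xs
    ≡⟨ cong (_- ∑ₗ f xs) (∑pick-cong xs (λ a ys p → ∑ₗ-↭ f p)) ⟩
  ∑pick (λ _ _ → ∑ₗ f xs) xs - ∑ₗ f xs
    ≡⟨ cong (_- ∑ₗ f xs) (∑pick-const (∑ₗ f xs) xs) ⟩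
  ι (length xs) * ∑ₗ f xs - ∑ₗ f xs
    ≡⟨ cong (λ l → ι l * ∑ₗ f xs - ∑ₗ f xs) len ⟩
  (1ℚ + ι k) * ∑ₗ f xs - ∑ₗ f xs
    ≡⟨ solve 2 (λ l s → (con 1ℚ :+ l) :* s :- s := l :* s) refl (ι k) (∑ₗ f xs) ⟩
  ι k * ∑ₗ f xs ∎
  where open ≡-Reasoning

-- Reordering `xs` also reorders the rests, hence the requirement that `h` ignore the order of its
-- second argument.
∑pick-↭ : ∀ (h : A → List A → ℚ) → (∀ a {ys zs} → ys ↭ zs → h a ys ≡ h a zs) →
          xs ↭ ys → ∑pick h xs ≡ ∑pick h ys
∑pick-↭ h h-↭ refl         = refl
∑pick-↭ h h-↭ (prep {xs} {ys} x p) = cong₂ _+_ (h-↭ x p)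
  (∑pick-↭ (λ a ys → h a (x ∷ ys)) (λ a q → h-↭ a (prep x q)) p)
∑pick-↭ h h-↭ (swap {xs} {ys} x y p) = ≡.trans
  (cong₂ _+_ (h-↭ x (prep y p)) (cong₂ _+_ (h-↭ y (prep x p))
    (≡.trans (∑pick-↭ (λ a zs → h a (x ∷ y ∷ zs)) (λ a q → h-↭ a (prep x (prep y q))) p)
             (∑pick-cong ys (λ a zs _ → h-↭ a (swap x y refl))))))
  (solve 3 (λ a b c → a :+ (b :+ c) := b :+ (a :+ c)) refl (h x (y ∷ ys)) (h y (x ∷ ys)) _)
∑pick-↭ h h-↭ (trans p q)  = ≡.trans (∑pick-↭ h h-↭ p) (∑pick-↭ h h-↭ q)

-- Both sides run over ordered pairs of distinct positions. Pairs that involve the head are split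
-- off; the induction hypothesis treats the others.
∑pick-swap : ∀ (h : A → A → List A → ℚ) xs →
  ∑pick (λ a → ∑pick (λ b → h a b)) xs ≡ ∑pick (λ b → ∑pick (λ a → h a b)) xs
∑pick-swap h []       = refl
∑pick-swap {A} h (x ∷ xs) = begin
  ∑pick (h x) xs + ∑pick (λ a ys → h a x ys + R a ys) xs
    ≡⟨ cong (λ s → ∑pick (h x) xs + s) (∑pick-+ (λ a → h a x) R xs) ⟩
  ∑pick (h x) xs + (∑pick (λ a → h a x) xs + ∑pick R xs)
    ≡⟨ cong (λ s → ∑pick (h x) xs + (∑pick (λ a → h a x) xs + s)) (∑pick-swap (λ a b zs → h a b (x ∷ zs)) xs) ⟩
  ∑pick (h x) xs + (∑pick (λ a → h a x) xs + ∑pick S xs)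
    ≡⟨ solve 3 (λ a b c → a :+ (b :+ c) := b :+ (a :+ c)) refl (∑pick (h x) xs) (∑pick (λ a → h a x) xs) (∑pick S xs) ⟩
  ∑pick (λ a → h a x) xs + (∑pick (h x) xs + ∑pick S xs)
    ≡⟨ cong (λ s → ∑pick (λ a → h a x) xs + s) (∑pick-+ (h x) S xs) ⟨
  ∑pick (λ a → h a x) xs + ∑pick (λ b ys → h x b ys + S b ys) xs ∎
  where
  open ≡-Reasoning
  R S : A → List A → ℚ
  R a = ∑pick (λ b zs → h a b (x ∷ zs))
  S b = ∑pick (λ a zs → h a b (x ∷ zs))

-- The index `j` matches the first factor of the product that defines `permutations (suc n)`.
∑pick-tabulate : ∀ (h : A → List A → ℚ) (f : Vector A (suc n)) →
  ∑pick h (tabulate f) ≡ ∑ₗ (λ j → h (f j) (tabulate (removeAt f j))) (allFin (suc n))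
∑pick-tabulate {n = n} h f = ≡.trans (go h f)
  (sym (∑ₗ-tabulate (λ j → h (f j) (tabulate (removeAt f j))) (λ j → j)))
  where
  go : ∀ {n} (h : A → List A → ℚ) (f : Vector A (suc n)) →
       ∑pick h (tabulate f) ≡ sum (λ j → h (f j) (tabulate (removeAt f j)))
  go {n = zero}  h f = refl
  go {n = suc n} h f = cong (λ s → h (f zero) (tabulate (f ∘ suc)) + s)
    (go (λ a ys → h a (f zero ∷ ys)) (f ∘ suc))

-- Sums over all orderings

-- The sum of g over the orderings of xs, a list of length k.
∑orders : ℕ → (List A → ℚ) → List A → ℚ
∑orders zero    g xs = g []
∑orders (suc k) g xs = ∑pick (λ a → ∑orders k (g ∘ (a ∷_))) xs

∑orders-mono : ∀ {f g : List A → ℚ} xs → length xs ≡ k → (∀ l → l ↭ xs → f l ≤ g l) →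
               ∑orders k f xs ≤ ∑orders k g xs
∑orders-mono {k = zero}  [] len f≤g = f≤g [] refl
∑orders-mono {k = suc k} xs len f≤g = ∑pick-mono xs λ a ys p →
  ∑orders-mono ys (ℕ.suc-injective (≡.trans (↭-length p) len))
    (λ l q → f≤g (a ∷ l) (trans (prep a q) p))

∑orders-cong : ∀ {f g : List A → ℚ} xs → length xs ≡ k → (∀ l → l ↭ xs → f l ≡ g l) →
               ∑orders k f xs ≡ ∑orders k g xs
∑orders-cong xs len f≡g = ≤-antisym
  (∑orders-mono xs len (λ l p → ≤-reflexive (f≡g l p)))
  (∑orders-mono xs len (λ l p → ≤-reflexive (sym (f≡g l p))))

∑orders-+ : ∀ k (f g : List A → ℚ) xs →
  ∑orders k (λ l → f l + g l) xs ≡ ∑orders k f xs + ∑orders k g xs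
∑orders-+ zero    f g xs = refl
∑orders-+ (suc k) f g xs = ≡.trans
  (∑pick-cong xs (λ a ys _ → ∑orders-+ k (f ∘ (a ∷_)) (g ∘ (a ∷_)) ys))
  (∑pick-+ (λ a → ∑orders k (f ∘ (a ∷_))) (λ a → ∑orders k (g ∘ (a ∷_))) xs)

∑orders-* : ∀ k c (f : List A → ℚ) xs → ∑orders k (λ l → c * f l) xs ≡ c * ∑orders k f xs
∑orders-* zero    c f xs = refl
∑orders-* (suc k) c f xs = ≡.trans
  (∑pick-cong xs (λ a ys _ → ∑orders-* k c (f ∘ (a ∷_)) ys))
  (∑pick-* c (λ a → ∑orders k (f ∘ (a ∷_))) xs)

-- permutations is built up from the first arrival, but the analysis
-- conditions on the last one.
∑orders-last : ∀ k (g : List A → ℚ) xs →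
  ∑orders (suc k) g xs ≡ ∑pick (λ a → ∑orders k (λ l → g (l ∷ʳ a))) xs
∑orders-last zero    g xs = refl
∑orders-last (suc k) g xs = ≡.trans
  (∑pick-cong xs (λ a ys _ → ∑orders-last k (g ∘ (a ∷_)) ys))
  (∑pick-swap (λ a b → ∑orders k (λ l → g (a ∷ l ∷ʳ b))) xs)

-- `acc` holds the earlier arrivals, newest first. Fixing the first arrival `f j` pushes it onto
-- `acc`, so it becomes the last entry of an ordering; `∑orders-last` then collects the choices of
-- `j`.
∑ₗ-permutations : ∀ n (g : List A → ℚ) (f : Vector A n) acc →
  ∑ₗ (λ σ → g (tabulate (λ i → f (σ ⟨$⟩ʳ i)) ʳ++ acc)) (permutations n)
  ≡ ∑orders n (λ l → g (l ++ acc)) (tabulate f)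
∑ₗ-permutations zero    g f acc = +-identityʳ (g acc)
∑ₗ-permutations {A} (suc n) g f acc = begin
  ∑ₗ G (permutations (suc n))
    ≡⟨ ∑ₗ-cartesianProductWith G (insert zero) (allFin (suc n)) (permutations n) ⟩
  ∑ₗ (λ j → ∑ₗ (λ ρ → G (insert zero j ρ)) (permutations n)) (allFin (suc n))
    ≡⟨ cong (foldr _+_ 0ℚ) (map-cong (λ j → ∑ₗ-permutations n g (removeAt f j) (f j ∷ acc)) (allFin (suc n))) ⟩
  ∑ₗ (λ j → ∑orders n (λ l → g (l ++ f j ∷ acc)) (tabulate (removeAt f j))) (allFin (suc n))
    ≡⟨ ∑pick-tabulate (λ a → ∑orders n (λ l → g (l ++ a ∷ acc))) f ⟨
  ∑pick (λ a → ∑orders n (λ l → g (l ++ a ∷ acc))) (tabulate f)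
    ≡⟨ ∑pick-cong (tabulate f) (λ a ys p → ∑orders-cong ys
         (ℕ.suc-injective (≡.trans (↭-length p) (length-tabulate f)))
         (λ l _ → cong g (∷ʳ-++ l a acc))) ⟨
  ∑pick (λ a → ∑orders n (λ l → g (l ∷ʳ a ++ acc))) (tabulate f)
    ≡⟨ ∑orders-last n (λ l → g (l ++ acc)) (tabulate f) ⟨
  ∑orders (suc n) (λ l → g (l ++ acc)) (tabulate f) ∎
  where
  open ≡-Reasoning
  G : Permutation′ (suc n) → ℚ
  G σ = g (tabulate (λ i → f (σ ⟨$⟩ʳ i)) ʳ++ acc)

-- Densities and the ranking of items

size≢0 : ∀ {a} → NonZero (size a)
size≢0 {a} = pos⇒nonZero (size a) {{positive (0<size a)}}

1/size : Item → ℚ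
1/size a = (1/ size a) {{size≢0 {a}}}

0≤1/size : ∀ a → 0ℚ ≤ 1/size a
0≤1/size a = nonNegative⁻¹ (1/size a)
  {{pos⇒nonNeg (1/size a) {{1/pos⇒pos (size a) {{positive (0<size a)}}}}}}

size*1/size : ∀ a → size a * 1/size a ≡ 1ℚ
size*1/size a = *-inverseʳ (size a) {{size≢0 {a}}}

0≤size : ∀ a → 0ℚ ≤ size a
0≤size a = <⇒≤ (0<size a)

density : Item → ℚ
density a = profit a * 1/size a

0≤density : ∀ a → 0ℚ ≤ density a
0≤density a = 0≤* (0≤profit a) (0≤1/size a)

profit≡density*size : ∀ a → profit a ≡ density a * size a
profit≡density*size a = begin
  profit a                          ≡⟨ *-identityʳ (profit a) ⟨
  profit a * 1ℚ                     ≡⟨ cong (profit a *_) (size*1/size a) ⟨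
  profit a * (size a * 1/size a)    ≡⟨ solve 3 (λ p s i → p :* (s :* i) := p :* i :* s) refl (profit a) (size a) (1/size a) ⟩
  density a * size a                ∎
  where open ≡-Reasoning

-- Identifiers break ties, so items with distinct identifiers are always strictly comparable.
rank : DecTotalOrder _ _ _
rank = On.decTotalOrder (×-decTotalOrder ≤-decTotalOrder ℕ.≤-decTotalOrder)
         (λ a → density a , ident a)

open DecTotalOrder rank using () renaming
  (_≤_ to _≼_; _≤?_ to _≼?_; antisym to ≼-antisym; totalOrder to ≼-totalOrder)

-- The two components are what `aboveSize` tests: `≺⇒≼` removes `a` from the level of `b`, and `≺⇒⋡`
-- counts `b` in the level of `a`.
record _≺_ (a b : Item) : Set where
  constructor _,_
  field
    ≺⇒≼ : a ≼ b
    ≺⇒⋡ : ¬ b ≼ a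

open _≺_

≺⇒density-≤ : ∀ {a b} → a ≺ b → density a ≤ density b
≺⇒density-≤ (inj₁ (d≤d′ , _) , _) = d≤d′
≺⇒density-≤ (inj₂ (d≡d′ , _) , _) = ≤-reflexive d≡d′

Distinct : List Item → Set
Distinct = Unique ∘ map ident

Distinct-resp-↭ : xs ↭ ys → Distinct xs → Distinct ys
Distinct-resp-↭ p = Permutationₛ.Unique-resp-↭ (≡.setoid ℕ) (↭⇒↭ₛ (map⁺ ident p))

sort-≺ : ∀ {xs} → Distinct xs → AllPairs _≺_ (sort rank xs)
sort-≺ {xs} distinct = go (Sorted⇒AllPairs ≼-totalOrder (sort-↗ rank xs))
  (Distinct-resp-↭ (↭-sym (sort-↭ rank xs)) distinct)
  where
  go : ∀ {xs} → AllPairs _≼_ xs → Distinct xs → AllPairs _≺_ xs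
  go []         []         = []
  go {a ∷ xs} (a≼ ∷ rel) (a≢ ∷ dis) =
    All.zipWith (λ {b} (a≼b , a≢b) → a≼b , λ b≼a → a≢b (proj₂ (≼-antisym {a} {b} a≼b b≼a)))
      (a≼ , All.map⁻ a≢)
    ∷ go rel dis

-- The greedy packing and its optimality

-- Item a occupies the part of the interval [0, W] that lies between
-- level a ys and level a ys + size a, where ys are the other items.
aboveSize : Item → Item → ℚ
aboveSize a b = if does (b ≼? a) then 0ℚ else size b

level : Item → List Item → ℚ
level a = ∑ₗ (aboveSize a)

aboveSize-≼ : ∀ a b → b ≼ a → aboveSize a b ≡ 0ℚ
aboveSize-≼ a b b≼a = cong (λ t → if t then 0ℚ else size b) (dec-true (b ≼? a) b≼a)

aboveSize-⋠ : ∀ a b → ¬ b ≼ a → aboveSize a b ≡ size b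
aboveSize-⋠ a b b⋠a = cong (λ t → if t then 0ℚ else size b) (dec-false (b ≼? a) b⋠a)

0≤level : ∀ a ys → 0ℚ ≤ level a ys
0≤level a = ∑ₗ-nonNeg (λ b → 0≤if (does (b ≼? a)) (0≤size b))
  where
  0≤if : ∀ t {p} → 0ℚ ≤ p → 0ℚ ≤ (if t then 0ℚ else p)
  0≤if true  _   = ≤-refl
  0≤if false 0≤p = 0≤p

level-least : ∀ {a} → All (a ≺_) ys → level a ys ≡ ∑ₗ size ys
level-least []                         = refl
level-least {b ∷ _} {a} ((_ , b⋠a) ∷ a≺) = cong₂ _+_ (aboveSize-⋠ a b b⋠a) (level-least a≺)

module Greedy (W : ℚ) .{{W⁺ : Positive W}} where

  0≤W : 0ℚ ≤ W
  0≤W = nonNegative⁻¹ W {{pos⇒nonNeg W}}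

  -- The greedy packing by density, written per item and without sorting, so that it evidently
  -- ignores the order of `ys`.
  amount : Item → List Item → ℚ
  amount a ys = W ⊓ (level a ys + size a) - W ⊓ level a ys

  amount-↭ : ∀ a → xs ↭ ys → amount a xs ≡ amount a ys
  amount-↭ a p = cong (λ l → W ⊓ (l + size a) - W ⊓ l) (∑ₗ-↭ (aboveSize a) p)

  0≤amount : ∀ a ys → 0ℚ ≤ amount a ys
  0≤amount a ys = p≤q⇒0≤q-p (⊓-monoʳ-≤ W
    (subst (_≤ level a ys + size a) (+-identityʳ (level a ys)) (+-monoʳ-≤ (level a ys) (0≤size a))))

  amount≤W : ∀ a ys → amount a ys ≤ W
  amount≤W a ys = subst (amount a ys ≤_) (+-identityʳ W)
    (+-mono-≤ (p⊓q≤p W (level a ys + size a)) (neg-antimono-≤ (⊓-glb 0≤W (0≤level a ys))))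

  amount≤size : ∀ a ys → amount a ys ≤ size a
  amount≤size a ys with ≤-total W (level a ys)
  ... | inj₁ W≤l = ≤-trans
    (+-mono-≤ (p⊓q≤p W (level a ys + size a)) (≤-reflexive (cong -_ (p≤q⇒p⊓q≡p W≤l))))
    (≤-trans (≤-reflexive (+-inverseʳ W)) (0≤size a))
  ... | inj₂ l≤W = ≤-trans
    (+-mono-≤ (p⊓q≤q W (level a ys + size a)) (≤-reflexive (cong -_ (p≥q⇒p⊓q≡q l≤W))))
    (≤-reflexive (solve 2 (λ l s → l :+ s :- l := s) refl (level a ys) (size a)))

  -- The lowest ranked item lies beyond all others in the interval and does not affect their levels.
  -- The general `φ` covers both total amount and total value.
  ∑pick-least : ∀ (φ : Item → ℚ → ℚ) {a} → All (a ≺_) ys →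
    ∑pick (λ b zs → φ b (amount b zs)) (a ∷ ys)
    ≡ φ a (W ⊓ (∑ₗ size ys + size a) - W ⊓ ∑ₗ size ys) + ∑pick (λ b zs → φ b (amount b zs)) ys
  ∑pick-least {ys} φ {a} a≺ = cong₂ _+_
    (cong (λ l → φ a (W ⊓ (l + size a) - W ⊓ l)) (level-least a≺))
    (∑pick-cong ys λ b zs p → cong (λ l → φ b (W ⊓ (l + size b) - W ⊓ l))
      (≡.trans (cong (_+ level b zs) (aboveSize-≼ b a (≺⇒≼ (All.head (All-resp-↭ (↭-sym p) a≺)))))
               (+-identityˡ (level b zs))))

  ∑pick-sort : ∀ (φ : Item → ℚ → ℚ) xs →
    ∑pick (λ b zs → φ b (amount b zs)) (sort rank xs) ≡ ∑pick (λ b zs → φ b (amount b zs)) xs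
  ∑pick-sort φ xs = ∑pick-↭ (λ b zs → φ b (amount b zs)) (λ b p → cong (φ b) (amount-↭ b p))
    (sort-↭ rank xs)

  private
    -- The intervals of the items tile `[0, ∑ₗ size xs]`, so their lengths, truncated at `W`,
    -- telescope.
    ∑amount-≺ : AllPairs _≺_ xs → ∑pick amount xs ≡ W ⊓ ∑ₗ size xs
    ∑amount-≺ []                      = sym (p≥q⇒p⊓q≡q 0≤W)
    ∑amount-≺ {xs = a ∷ ys} (a≺ ∷ ≺s) = begin
      ∑pick amount (a ∷ ys)
        ≡⟨ ∑pick-least (λ _ z → z) {a} a≺ ⟩
      W ⊓ (∑ₗ size ys + size a) - W ⊓ ∑ₗ size ys + ∑pick amount ys
        ≡⟨ cong (λ s → W ⊓ (∑ₗ size ys + size a) - W ⊓ ∑ₗ size ys + s) (∑amount-≺ ≺s) ⟩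
      W ⊓ (∑ₗ size ys + size a) - W ⊓ ∑ₗ size ys + W ⊓ ∑ₗ size ys
        ≡⟨ solve 2 (λ p q → p :- q :+ q := p) refl (W ⊓ (∑ₗ size ys + size a)) (W ⊓ ∑ₗ size ys) ⟩
      W ⊓ (∑ₗ size ys + size a)
        ≡⟨ cong (W ⊓_) (+-comm (∑ₗ size ys) (size a)) ⟩
      W ⊓ (size a + ∑ₗ size ys) ∎
      where open ≡-Reasoning

  ∑amount≤W : Distinct xs → ∑pick amount xs ≤ W
  ∑amount≤W {xs} distinct = subst (_≤ W)
    (≡.trans (sym (∑amount-≺ (sort-≺ distinct))) (∑pick-sort (λ _ z → z) xs))
    (p⊓q≤p W (∑ₗ size (sort rank xs)))

  -- `u` stands for the amounts of capacity used by an arbitrary competing packing.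
  module _ (u : Item → ℚ) (0≤u : ∀ a → 0ℚ ≤ u a) (u≤size : ∀ a → u a ≤ size a) where

    private
      -- Abel summation: peeling off the least dense item raises the bound δ
      -- on the densities of the other items to the density of that item.
      greedy-optimal-≺ : ∀ δ → AllPairs _≺_ xs → All (λ a → δ ≤ density a) xs → ∑ₗ u xs ≤ W →
        δ * (∑pick amount xs - ∑ₗ u xs)
        ≤ ∑pick (λ a ys → density a * amount a ys) xs - ∑ₗ (λ a → density a * u a) xs
      greedy-optimal-≺ δ [] [] _ = ≤-reflexive (*-zeroʳ δ)
      greedy-optimal-≺ {xs = a ∷ ys} δ (a≺ ∷ ≺s) (δ≤d ∷ _) fits = 0≤q-p⇒p≤q
        (subst (0ℚ ≤_) (rearrange (∑pick-least (λ _ z → z) {a} a≺) (∑pick-least (λ a z → density a * z) {a} a≺))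
          (0≤+ (p≤q⇒0≤q-p IH) (0≤* (p≤q⇒0≤q-p δ≤d) (p≤q⇒0≤q-p U≤Z))))
        where
        d z Z′ U′ P′ Q′ : ℚ
        d = density a
        z = W ⊓ (∑ₗ size ys + size a) - W ⊓ ∑ₗ size ys
        Z′ = ∑pick amount ys
        U′ = ∑ₗ u ys
        P′ = ∑pick (λ a ys → density a * amount a ys) ys
        Q′ = ∑ₗ (λ a → density a * u a) ys
        IH : d * (Z′ - U′) ≤ P′ - Q′
        IH = greedy-optimal-≺ d ≺s (All.map ≺⇒density-≤ a≺)
          (≤-trans (subst (_≤ u a + U′) (+-identityˡ U′) (+-monoˡ-≤ U′ (0≤u a))) fits)
        -- The greedy packing uses `W ⊓ ∑ₗ size (a ∷ ys)`, the most that capacity and sizes allow.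
        U≤Z : ∑ₗ u (a ∷ ys) ≤ ∑pick amount (a ∷ ys)
        U≤Z = subst (∑ₗ u (a ∷ ys) ≤_) (sym (∑amount-≺ (a≺ ∷ ≺s)))
          (⊓-glb fits (∑ₗ-mono u≤size (a ∷ ys)))
        -- The gap in the claim is the gap in `IH` plus `d - δ` times the surplus of the greedy
        -- amounts over `u`.
        rearrange : ∀ {Z P} → Z ≡ z + Z′ → P ≡ d * z + P′ →
          P′ - Q′ - d * (Z′ - U′) + (d - δ) * (Z - (u a + U′))
          ≡ P - (d * u a + Q′) - δ * (Z - (u a + U′))
        rearrange refl refl =
          solve 8 (λ d δ z Z′ u U′ P′ Q′ →
              P′ :- Q′ :- d :* (Z′ :- U′) :+ (d :- δ) :* (z :+ Z′ :- (u :+ U′))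
              := d :* z :+ P′ :- (d :* u :+ Q′) :- δ :* (z :+ Z′ :- (u :+ U′)))
            refl d δ z Z′ (u a) U′ P′ Q′

    -- For `δ = 0` the left side of `greedy-optimal-≺` vanishes, and both sums are unchanged by
    -- sorting.
    greedy-optimal : Distinct xs → ∑ₗ u xs ≤ W →
      ∑ₗ (λ a → density a * u a) xs ≤ ∑pick (λ a ys → density a * amount a ys) xs
    greedy-optimal {xs} distinct fits = subst₂ _≤_
      (∑ₗ-↭ (λ a → density a * u a) p) (∑pick-sort (λ a z → density a * z) xs)
      (0≤q-p⇒p≤q (≤-trans (≤-reflexive (sym (*-zeroˡ (∑pick amount (sort rank xs) - ∑ₗ u (sort rank xs)))))
        (greedy-optimal-≺ 0ℚ (sort-≺ distinct) (All.universal 0≤density (sort rank xs))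
          (subst (_≤ W) (sym (∑ₗ-↭ u p)) fits))))
      where
      p : sort rank xs ↭ xs
      p = sort-↭ rank xs

-- Recursive bounds on free capacity and profit

*-mono-≤-nonNeg : ∀ {p q r s} → 0ℚ ≤ r → 0ℚ ≤ q → p ≤ q → r ≤ s → p * r ≤ q * s
*-mono-≤-nonNeg {p} {q} {r} {s} 0≤r 0≤q p≤q r≤s = ≤-trans
  (*-monoʳ-≤-nonNeg r {{nonNegative 0≤r}} p≤q) (*-monoˡ-≤-nonNeg q {{nonNegative 0≤q}} r≤s)

ι-∸ : ∀ {j k} → j ℕ.≤ k → ι (k ∸ j) ≡ ι k - ι j
ι-∸ {j} {k} j≤k = begin
  ι (k ∸ j)                ≡⟨ solve 2 (λ a b → a := a :+ b :- b) refl (ι (k ∸ j)) (ι j) ⟩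
  ι (k ∸ j) + ι j - ι j    ≡⟨ cong (_- ι j) (·-homo-+ 1ℚ (k ∸ j) j) ⟨
  ι (k ∸ j ℕ.+ j) - ι j    ≡⟨ cong (λ i → ι i - ι j) (ℕ.m∸n+n≡m j≤k) ⟩
  ι k - ι j                ∎
  where open ≡-Reasoning

-- Here `k` counts the earlier arrivals, so exactly the first `m` rounds are inactive. The value is
-- a number because it serves as a factor.
active : ℕ → ℕ → ℕ
active m k = if k <ᵇ m then 0 else 1

active≤1 : ∀ m k → active m k ℕ.≤ 1
active≤1 m k with k <ᵇ m
... | true  = ℕ.z≤n
... | false = ℕ.≤-refl

-- After k rounds, massBound m k / k ! is a lower bound on the expected free
-- part of the capacity, and gainBound m k / k ! one on the expected profit
-- relative to that of any feasible packing of the revealed items.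
massBound gainBound : ℕ → ℕ → ℕ
massBound m zero    = 1
massBound m (suc k) = (suc k ∸ active m k) ℕ.* massBound m k
gainBound m zero    = 0
gainBound m (suc k) = active m k ℕ.* massBound m k ℕ.+ k ℕ.* gainBound m k

-- The online policy and its analysis

-- The lists of items below are histories, latest item first.
module Policy (m : ℕ) (W : ℚ) .{{W⁺ : Positive W}} where

  open Greedy W

  private instance
    W≢0 : NonZero W
    W≢0 = pos⇒nonZero W

  0≤1/W : 0ℚ ≤ 1/ W
  0≤1/W = nonNegative⁻¹ (1/ W) {{pos⇒nonNeg (1/ W) {{1/pos⇒pos W}}}}

  tentative : Item → List Item → ℚ
  tentative a rs = ι (active m (length rs)) * amount a rs

  0≤tentative : ∀ a rs → 0ℚ ≤ tentative a rs
  0≤tentative a rs = 0≤* (0≤ι (active m (length rs))) (0≤amount a rs)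

  tentative≤amount : ∀ a rs → tentative a rs ≤ amount a rs
  tentative≤amount a rs = ≤-trans
    (*-monoʳ-≤-nonNeg (amount a rs) {{nonNegative (0≤amount a rs)}} (ι-mono (active≤1 m (length rs))))
    (≤-reflexive (*-identityˡ (amount a rs)))

  tentative-↭ : ∀ a {xs ys} → xs ↭ ys → tentative a xs ≡ tentative a ys
  tentative-↭ a p = cong₂ (λ l z → ι (active m l) * z) (↭-length p) (amount-↭ a p)

  unused : Item → List Item → ℚ
  unused a rs = 1ℚ - tentative a rs * 1/ W

  remaining : List Item → ℚ
  remaining []       = 1ℚ
  remaining (a ∷ rs) = unused a rs * remaining rs

  fraction : List Item → ℚ
  fraction []       = 0ℚ
  fraction (a ∷ rs) = tentative a rs * 1/size a * remaining rs

  total : (Item → ℚ) → List Item → ℚ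
  total w []       = 0ℚ
  total w (a ∷ rs) = w a * fraction (a ∷ rs) + total w rs

  0≤unused : ∀ a rs → 0ℚ ≤ unused a rs
  0≤unused a rs = p≤q⇒0≤q-p (≤-trans
    (*-monoʳ-≤-nonNeg (1/ W) {{nonNegative 0≤1/W}} (≤-trans (tentative≤amount a rs) (amount≤W a rs)))
    (≤-reflexive (*-inverseʳ W)))

  unused≤1 : ∀ a rs → unused a rs ≤ 1ℚ
  unused≤1 a rs = 0≤q-p⇒p≤q (subst (0ℚ ≤_)
    (solve 1 (λ t → t := con 1ℚ :- (con 1ℚ :- t)) refl (tentative a rs * 1/ W))
    (0≤* (0≤tentative a rs) 0≤1/W))

  0≤remaining : ∀ rs → 0ℚ ≤ remaining rs
  0≤remaining []       = nonNegative⁻¹ 1ℚ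
  0≤remaining (a ∷ rs) = 0≤* (0≤unused a rs) (0≤remaining rs)

  remaining≤1 : ∀ rs → remaining rs ≤ 1ℚ
  remaining≤1 []       = ≤-refl
  remaining≤1 (a ∷ rs) = *-mono-≤-nonNeg (0≤remaining rs) (nonNegative⁻¹ 1ℚ) (unused≤1 a rs) (remaining≤1 rs)

  0≤fraction : ∀ rs → 0ℚ ≤ fraction rs
  0≤fraction []       = ≤-refl
  0≤fraction (a ∷ rs) = 0≤* (0≤* (0≤tentative a rs) (0≤1/size a)) (0≤remaining rs)

  fraction≤1 : ∀ rs → fraction rs ≤ 1ℚ
  fraction≤1 []       = nonNegative⁻¹ 1ℚ
  fraction≤1 (a ∷ rs) = *-mono-≤-nonNeg (0≤remaining rs) (nonNegative⁻¹ 1ℚ)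
    (≤-trans (*-monoʳ-≤-nonNeg (1/size a) {{nonNegative (0≤1/size a)}}
               (≤-trans (tentative≤amount a rs) (amount≤size a rs)))
             (≤-reflexive (size*1/size a)))
    (remaining≤1 rs)

  -- The round of `a` packs size `W * (remaining rs - remaining (a ∷ rs))`, so the sizes telescope.
  -- Feasibility thus holds for every arrival order.
  total-size : ∀ rs → total size rs ≡ W * (1ℚ - remaining rs)
  total-size []       = sym (*-zeroʳ W)
  total-size (a ∷ rs) = begin
    size a * (t * 1/size a * r) + total size rs
      ≡⟨ cong (λ s → size a * (t * 1/size a * r) + s) (total-size rs) ⟩
    size a * (t * 1/size a * r) + W * (1ℚ - r)
      ≡⟨ solve 5 (λ s i t r w → s :* (t :* i :* r) :+ w :* (con 1ℚ :- r) := s :* i :* (t :* r) :+ w :* (con 1ℚ :- r))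
           refl (size a) (1/size a) t r W ⟩
    size a * 1/size a * (t * r) + W * (1ℚ - r)
      -- Both `size a * 1/size a` and `W * 1/ W` are `1ℚ`; after the exchange a ring identity
      -- remains.
      ≡⟨ cong (λ o → o * (t * r) + W * (1ℚ - r)) (≡.trans (size*1/size a) (sym (*-inverseʳ W))) ⟩
    W * 1/ W * (t * r) + W * (1ℚ - r)
      ≡⟨ solve 4 (λ w i t r → w :* i :* (t :* r) :+ w :* (con 1ℚ :- r)
                              := w :* (con 1ℚ :- (con 1ℚ :- t :* i) :* r))
           refl W (1/ W) t r ⟩
    W * (1ℚ - (1ℚ - t * 1/ W) * r) ∎
    where
    open ≡-Reasoning
    t r : ℚ
    t = tentative a rs
    r = remaining rs

  total-size≤W : ∀ rs → total size rs ≤ W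
  total-size≤W rs = ≤-trans (≤-reflexive (total-size rs)) (subst (W * (1ℚ - remaining rs) ≤_) (*-identityʳ W)
    (*-monoˡ-≤-nonNeg W {{pos⇒nonNeg W}} (subst (1ℚ - remaining rs ≤_) (+-identityʳ 1ℚ)
      (+-monoʳ-≤ 1ℚ (neg-antimono-≤ (0≤remaining rs))))))

  -- Induction over the rounds: the first item of `f` moves from the sum into the history `acc`.
  sum-rounds : ∀ {n} w (f : Vector Item n) acc →
    sum (λ ℓ → w (f ℓ) * fraction (take (suc (toℕ ℓ)) (tabulate f) ʳ++ acc)) + total w acc
    ≡ total w (tabulate f ʳ++ acc)
  sum-rounds {n = zero}  w f acc = +-identityˡ (total w acc)
  sum-rounds {n = suc n} w f acc = ≡.trans
    (solve 3 (λ a s t → a :+ s :+ t := s :+ (a :+ t)) refl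
      (w (f zero) * fraction (f zero ∷ acc))
      (sum (λ ℓ → w (f (suc ℓ)) * fraction (take (suc (toℕ ℓ)) (tabulate (f ∘ suc)) ʳ++ f zero ∷ acc)))
      (total w acc))
    (sum-rounds w (f ∘ suc) (f zero ∷ acc))

  rest-length : ∀ {a : Item} {xs ys} → a ∷ ys ↭ xs → length xs ≡ suc k → length ys ≡ k
  rest-length p len = ℕ.suc-injective (≡.trans (↭-length p) len)

  rest-distinct : ∀ {a xs ys} → a ∷ ys ↭ xs → Distinct xs → Distinct ys
  rest-distinct p distinct with Distinct-resp-↭ (↭-sym p) distinct
  ... | _ ∷ distinct-ys = distinct-ys

  -- Over all choices of the newest item, the greedy amounts sum to at most `W`, so the capacity
  -- shares lost sum to at most `active m k`.
  ∑unused : ∀ xs → length xs ≡ suc k → Distinct xs → ι (suc k ∸ active m k) ≤ ∑pick unused xs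
  ∑unused {k} xs len distinct = 0≤q-p⇒p≤q (subst (0ℚ ≤_) (sym difference)
    (0≤* (0≤* (0≤ι (active m k)) 0≤1/W) (p≤q⇒0≤q-p (∑amount≤W distinct))))
    where
    open ≡-Reasoning
    χ Z : ℚ
    χ = ι (active m k)
    Z = ∑pick amount xs
    difference : ∑pick unused xs - ι (suc k ∸ active m k) ≡ χ * 1/ W * (W - Z)
    difference = begin
      ∑pick unused xs - ι (suc k ∸ active m k)
        ≡⟨ cong₂ _-_
             (∑pick-cong xs (λ a ys p → ≡.trans
               (cong (λ l → 1ℚ - ι (active m l) * amount a ys * 1/ W) (rest-length p len))
               (solve 3 (λ x z i → con 1ℚ :- x :* z :* i := con 1ℚ :+ (con 0ℚ :- x :* i) :* z)
                 refl χ (amount a ys) (1/ W))))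
             (ι-∸ (ℕ.≤-trans (active≤1 m k) (ℕ.s≤s ℕ.z≤n))) ⟩
      ∑pick (λ a ys → 1ℚ + (0ℚ - χ * 1/ W) * amount a ys) xs - (ι (suc k) - χ)
        ≡⟨ cong (_- (ι (suc k) - χ)) (≡.trans
             (∑pick-+ (λ _ _ → 1ℚ) (λ a ys → (0ℚ - χ * 1/ W) * amount a ys) xs)
             (cong₂ _+_ (≡.trans (∑pick-const 1ℚ xs) (cong (λ l → ι l * 1ℚ) len))
                        (∑pick-* (0ℚ - χ * 1/ W) amount xs))) ⟩
      ι (suc k) * 1ℚ + (0ℚ - χ * 1/ W) * Z - (ι (suc k) - χ)
        ≡⟨ solve 4 (λ l x i z → l :* con 1ℚ :+ (con 0ℚ :- x :* i) :* z :- (l :- x)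
                                := x :* con 1ℚ :- x :* i :* z)
             refl (ι (suc k)) χ (1/ W) Z ⟩
      χ * 1ℚ - χ * 1/ W * Z
        ≡⟨ cong (λ o → χ * o - χ * 1/ W * Z) (sym (*-inverseʳ W)) ⟩
      χ * (W * 1/ W) - χ * 1/ W * Z
        ≡⟨ solve 4 (λ x w i z → x :* (w :* i) :- x :* i :* z := x :* i :* (w :- z)) refl χ W (1/ W) Z ⟩
      χ * 1/ W * (W - Z) ∎

  -- For `xs` of length `k` this is `k !` times the expected free part of the capacity after `xs`
  -- has arrived.
  mass : ℕ → List Item → ℚ
  mass k = ∑orders k remaining

  massBound≤mass : ∀ k xs → length xs ≡ k → Distinct xs → ι (massBound m k) ≤ mass k xs
  massBound≤mass zero    xs len distinct = ≤-refl
  massBound≤mass (suc k) xs len distinct = begin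
    ι ((suc k ∸ active m k) ℕ.* massBound m k)
      ≡⟨ ·1-homo-* (suc k ∸ active m k) (massBound m k) ⟩
    ι (suc k ∸ active m k) * ι (massBound m k)
      ≤⟨ *-monoʳ-≤-nonNeg (ι (massBound m k)) {{nonNegative (0≤ι (massBound m k))}} (∑unused xs len distinct) ⟩
    ∑pick unused xs * ι (massBound m k)
      ≡⟨ *-comm (∑pick unused xs) (ι (massBound m k)) ⟩
    ι (massBound m k) * ∑pick unused xs
      ≡⟨ ∑pick-* (ι (massBound m k)) unused xs ⟨
    ∑pick (λ a ys → ι (massBound m k) * unused a ys) xs
      ≤⟨ ∑pick-mono xs (λ a ys p → ≤-trans
           (*-monoʳ-≤-nonNeg (unused a ys) {{nonNegative (0≤unused a ys)}}
             (massBound≤mass k ys (rest-length p len) (rest-distinct p distinct)))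
           (≤-reflexive (mass-∷ a ys (rest-length p len)))) ⟩
    mass (suc k) xs ∎
    where
    open ≤-Reasoning
    mass-∷ : ∀ a ys → length ys ≡ k → mass k ys * unused a ys ≡ ∑orders k (λ l → remaining (a ∷ l)) ys
    mass-∷ a ys len = ≡.trans (*-comm (mass k ys) (unused a ys)) (≡.trans
      (sym (∑orders-* k (unused a ys) remaining ys))
      (∑orders-cong ys len (λ l p → cong (λ t → (1ℚ - t * 1/ W) * remaining l) (tentative-↭ a (↭-sym p)))))

  module _ (u : Item → ℚ) (0≤u : ∀ a → 0ℚ ≤ u a) (u≤size : ∀ a → u a ≤ size a) where

    private
      v : Item → ℚ
      v a = density a * u a

    -- Over all choices of the newest item, the greedy values sum to at least `∑ₗ v xs`, and each is
    -- scaled by the mass the others leave. For the earlier rounds `u` still fits on `ys`, and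
    -- `∑pick-rest` supplies the factor `k`.
    gainBound≤gain : ∀ k xs → length xs ≡ k → Distinct xs → ∑ₗ u xs ≤ W →
      ι (gainBound m k) * ∑ₗ v xs ≤ ∑orders k (total profit) xs
    gainBound≤gain zero    xs len distinct fits = ≤-reflexive (*-zeroˡ (∑ₗ v xs))
    gainBound≤gain (suc k) xs len distinct fits = begin
      ι (active m k ℕ.* massBound m k ℕ.+ k ℕ.* gainBound m k) * V
        ≡⟨ cong (_* V) (≡.trans (·-homo-+ 1ℚ (active m k ℕ.* massBound m k) (k ℕ.* gainBound m k))
             (cong₂ _+_ (·1-homo-* (active m k) (massBound m k)) (·1-homo-* k (gainBound m k)))) ⟩
      (χ * M + ι k * G) * V
        ≡⟨ solve 5 (λ x m k g v → (x :* m :+ k :* g) :* v := x :* m :* v :+ g :* (k :* v))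
             refl χ M (ι k) G V ⟩
      χ * M * V + G * (ι k * V)
        ≤⟨ +-monoˡ-≤ (G * (ι k * V)) (*-monoˡ-≤-nonNeg (χ * M) {{nonNegative 0≤χM}}
             (greedy-optimal u 0≤u u≤size distinct fits)) ⟩
      χ * M * ∑pick (λ a ys → density a * amount a ys) xs + G * (ι k * V)
        ≡⟨ cong₂ _+_ (∑pick-* (χ * M) (λ a ys → density a * amount a ys) xs)
             (≡.trans (∑pick-* G (λ _ ys → ∑ₗ v ys) xs) (cong (G *_) (∑pick-rest v xs len))) ⟨
      ∑pick (λ a ys → χ * M * (density a * amount a ys)) xs + ∑pick (λ _ ys → G * ∑ₗ v ys) xs
        ≡⟨ ∑pick-+ (λ a ys → χ * M * (density a * amount a ys)) (λ _ ys → G * ∑ₗ v ys) xs ⟨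
      ∑pick (λ a ys → χ * M * (density a * amount a ys) + G * ∑ₗ v ys) xs
        ≤⟨ ∑pick-mono xs (λ a ys p → ≤-trans
             (+-mono-≤ (now-≤ a ys p)
               (gainBound≤gain k ys (rest-length p len) (rest-distinct p distinct) (≤-trans (rest-u p) fits)))
             (≤-reflexive (sym (gain-∷ a ys (rest-length p len))))) ⟩
      ∑orders (suc k) (total profit) xs ∎
      where
      open ≤-Reasoning
      V χ M G : ℚ
      V = ∑ₗ v xs
      χ = ι (active m k)
      M = ι (massBound m k)
      G = ι (gainBound m k)

      0≤χM : 0ℚ ≤ χ * M
      0≤χM = 0≤* (0≤ι (active m k)) (0≤ι (massBound m k))

      rest-u : ∀ {a ys} → a ∷ ys ↭ xs → ∑ₗ u ys ≤ ∑ₗ u xs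
      rest-u {a} {ys} p = subst₂ _≤_ (+-identityˡ (∑ₗ u ys)) (∑ₗ-↭ u p) (+-monoˡ-≤ (∑ₗ u ys) (0≤u a))

      rate : Item → List Item → ℚ
      rate a ys = profit a * (tentative a ys * 1/size a)

      0≤rate : ∀ a ys → 0ℚ ≤ rate a ys
      0≤rate a ys = 0≤* (0≤profit a) (0≤* (0≤tentative a ys) (0≤1/size a))

      now-≤ : ∀ a ys → a ∷ ys ↭ xs → χ * M * (density a * amount a ys) ≤ rate a ys * mass k ys
      now-≤ a ys p = ≤-trans
        (≤-reflexive (≡.trans
          (solve 5 (λ x m w i z → x :* m :* (w :* i :* z) := w :* (x :* z :* i) :* m)
            refl χ M (profit a) (1/size a) (amount a ys))
          (cong (λ l → profit a * (ι (active m l) * amount a ys * 1/size a) * M) (sym (rest-length p len)))))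
        (*-monoˡ-≤-nonNeg (rate a ys) {{nonNegative (0≤rate a ys)}}
          (massBound≤mass k ys (rest-length p len) (rest-distinct p distinct)))

      gain-∷ : ∀ a ys → length ys ≡ k →
        ∑orders k (λ l → total profit (a ∷ l)) ys ≡ rate a ys * mass k ys + ∑orders k (total profit) ys
      gain-∷ a ys len = ≡.trans
        (∑orders-cong ys len (λ l p → cong (_+ total profit l) (≡.trans
          (cong (λ t → profit a * (t * 1/size a * remaining l)) (tentative-↭ a p))
          (sym (*-assoc (profit a) (tentative a ys * 1/size a) (remaining l))))))
        (≡.trans (∑orders-+ k (λ l → rate a ys * remaining l) (total profit) ys)
          (cong (_+ ∑orders k (total profit) ys) (∑orders-* k (rate a ys) remaining ys)))

-- Evaluation of the bounds

toℚᵘ-ι : ∀ k → toℚᵘ (ι k) ℚᵘ.≃ ℚᵘ.mkℚᵘ (+ k) 0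
toℚᵘ-ι zero    = ℚᵘ.≃-refl
toℚᵘ-ι (suc k) = ℚᵘ.≃-trans (toℚᵘ-homo-+ 1ℚ (ι k)) (ℚᵘ.≃-trans
  (ℚᵘ.+-cong (ℚᵘ.≃-refl {toℚᵘ 1ℚ}) (toℚᵘ-ι k))
  (ℚᵘ.*≡* (cong (ℤ._* + 1) (cong (λ j → + 1 ℤ.+ j) (ℤ.*-identityʳ (+ k))))))

-- Computed with unnormalised rationals, since `_/_` cancels common factors.
/*ι : ∀ a b .{{_ : ℕ.NonZero b}} → (+ a / b) * ι b ≡ ι a
/*ι a (suc b) = toℚᵘ-injective (begin
  toℚᵘ ((+ a / suc b) * ι (suc b))              ≈⟨ toℚᵘ-homo-* (+ a / suc b) (ι (suc b)) ⟩
  toℚᵘ (+ a / suc b) ℚᵘ.* toℚᵘ (ι (suc b))      ≈⟨ ℚᵘ.*-cong (toℚᵘ-fromℚᵘ (ℚᵘ.mkℚᵘ (+ a) b)) (toℚᵘ-ι (suc b)) ⟩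
  ℚᵘ.mkℚᵘ (+ a) b ℚᵘ.* ℚᵘ.mkℚᵘ (+ suc b) 0      ≈⟨ ℚᵘ.*≡* (ℤ.*-assoc (+ a) (+ suc b) (+ 1)) ⟩
  ℚᵘ.mkℚᵘ (+ a) 0                               ≈⟨ toℚᵘ-ι a ⟨
  toℚᵘ (ι a)                                    ∎)
  where open ℚᵘ.≃-Reasoning

/*ι≤ι : ∀ a b .{{_ : ℕ.NonZero b}} {f g} → a ℕ.* f ℕ.≤ b ℕ.* g → (+ a / b) * ι f ≤ ι g
/*ι≤ι a (suc b) {f} {g} af≤bg = *-cancelˡ-≤-pos (ι (suc b)) {{ι⁺}} (begin
  ι (suc b) * ((+ a / suc b) * ι f)    ≡⟨ solve 3 (λ x y z → x :* (y :* z) := y :* x :* z) refl (ι (suc b)) (+ a / suc b) (ι f) ⟩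
  (+ a / suc b) * ι (suc b) * ι f      ≡⟨ cong (_* ι f) (/*ι a (suc b)) ⟩
  ι a * ι f                            ≡⟨ ·1-homo-* a f ⟨
  ι (a ℕ.* f)                          ≤⟨ ι-mono af≤bg ⟩
  ι (suc b ℕ.* g)                      ≡⟨ ·1-homo-* (suc b) g ⟩
  ι (suc b) * ι g                      ∎)
  where
  open ≤-Reasoning
  ι⁺ : Positive (ι (suc b))
  ι⁺ = positive (+-mono-<-≤ (positive⁻¹ 1ℚ) (0≤ι b))

active-before : ∀ {m k} → k ℕ.< m → active m k ≡ 0
active-before {m} {k} k<m = cong (λ t → if t then 0 else 1) (dec-true (k ℕ.<? m) k<m)

active-after : ∀ {m k} → m ℕ.≤ k → active m k ≡ 1
active-after {m} {k} m≤k = cong (λ t → if t then 0 else 1) (dec-false (k ℕ.<? m) (ℕ.≤⇒≯ m≤k))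

massBound-before : ∀ {m} k → k ℕ.≤ m → massBound m k ≡ k !
massBound-before zero    _   = refl
massBound-before (suc k) k<m = cong₂ (λ x y → (suc k ∸ x) ℕ.* y)
  (active-before k<m) (massBound-before k (ℕ.<⇒≤ k<m))

-- The factors `r / suc r` of the active rounds telescope, so `massBound / k !` is `m / k` at
-- `k = j + m`; stated without division.
massBound-after : ∀ m j → (j ℕ.+ m) ℕ.* massBound m (j ℕ.+ m) ≡ m ℕ.* (j ℕ.+ m) !
massBound-after m zero    = cong (m ℕ.*_) (massBound-before m ℕ.≤-refl)
massBound-after m (suc j) = begin
  suc r ℕ.* ((suc r ∸ active m r) ℕ.* massBound m r)
    ≡⟨ cong (λ x → suc r ℕ.* ((suc r ∸ x) ℕ.* massBound m r)) (active-after (ℕ.m≤n+m m j)) ⟩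
  suc r ℕ.* (r ℕ.* massBound m r)
    ≡⟨ cong (suc r ℕ.*_) (massBound-after m j) ⟩
  suc r ℕ.* (m ℕ.* r !)
    ≡⟨ ℕSolver.solve 3 (λ s m f → s ⊗ (m ⊗ f) ⊜ m ⊗ (s ⊗ f)) refl (suc r) m (r !) ⟩
  m ℕ.* (suc r ℕ.* r !) ∎
  where
  open ≡-Reasoning
  r : ℕ
  r = j ℕ.+ m

-- Every active round `r` finds a free part of at least `m / r`, hence of `m / n`. After `j` of
-- them, at `k = j + m`, this makes `gainBound / k !` at least `(m / n) * (j / k)`.
gainBound-after : ∀ {n} m j → j ℕ.+ m ℕ.≤ n →
  m ℕ.* j ℕ.* (j ℕ.+ m) ! ℕ.≤ n ℕ.* (j ℕ.+ m) ℕ.* gainBound m (j ℕ.+ m)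
gainBound-after m zero _ = ℕ.≤-trans (ℕ.≤-reflexive (cong (ℕ._* m !) (ℕ.*-zeroʳ m))) ℕ.z≤n
gainBound-after {n} m (suc j) r<n = begin
  m ℕ.* suc j ℕ.* (suc r ℕ.* r !)
    ≡⟨ ℕSolver.solve 4 (λ m j s f → m ⊗ (‵ 1 ⊕ j) ⊗ (s ⊗ f) ⊜ s ⊗ (m ⊗ f ⊕ m ⊗ j ⊗ f))
         refl m j (suc r) (r !) ⟩
  suc r ℕ.* (m ℕ.* r ! ℕ.+ m ℕ.* j ℕ.* r !)
    ≤⟨ ℕ.*-monoʳ-≤ (suc r) (ℕ.+-mono-≤
         (ℕ.≤-trans (ℕ.≤-reflexive (sym (massBound-after m j))) (ℕ.*-monoˡ-≤ (massBound m r) (ℕ.<⇒≤ r<n)))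
         (gainBound-after m j (ℕ.<⇒≤ r<n))) ⟩
  suc r ℕ.* (n ℕ.* massBound m r ℕ.+ n ℕ.* r ℕ.* gainBound m r)
    ≡⟨ ℕSolver.solve 5 (λ s n b r g → s ⊗ (n ⊗ b ⊕ n ⊗ r ⊗ g)
                                ⊜ n ⊗ s ⊗ (‵ 1 ⊗ b ⊕ r ⊗ g))
         refl (suc r) n (massBound m r) r (gainBound m r) ⟩
  n ℕ.* suc r ℕ.* (1 ℕ.* massBound m r ℕ.+ r ℕ.* gainBound m r)
    ≡⟨ cong (λ x → n ℕ.* suc r ℕ.* (x ℕ.* massBound m r ℕ.+ r ℕ.* gainBound m r)) (active-after (ℕ.m≤n+m m j)) ⟨
  n ℕ.* suc r ℕ.* gainBound m (suc r) ∎
  where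
  open ℕ.≤-Reasoning
  r : ℕ
  r = j ℕ.+ m

⌈n/2⌉-cases : ∀ n → ⌈ n /2⌉ ≡ ⌊ n /2⌋ ⊎ ⌈ n /2⌉ ≡ suc ⌊ n /2⌋
⌈n/2⌉-cases zero          = inj₁ refl
⌈n/2⌉-cases (suc zero)    = inj₂ refl
⌈n/2⌉-cases (suc (suc n)) = Sum.map (cong suc) (cong suc) (⌈n/2⌉-cases n)

-- The margin between 4 and 4.39 absorbs odd `n`: for `j = suc m` the claim amounts to
-- `100 ≤ 39 * m * suc m`, which fails at `m = 1` and holds from `m = 2` on.
halves-product : ∀ {m j} → 2 ℕ.≤ m → j ≡ m ⊎ j ≡ suc m →
  100 ℕ.* ((j ℕ.+ m) ℕ.* (j ℕ.+ m)) ℕ.≤ 439 ℕ.* (m ℕ.* j)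
halves-product {m} _ (inj₁ refl) = ℕ.m+n≤o⇒m≤o _ (ℕ.≤-reflexive
  (ℕSolver.solve 1 (λ m → ‵ 100 ⊗ ((m ⊕ m) ⊗ (m ⊕ m)) ⊕ ‵ 39 ⊗ (m ⊗ m) ⊜ ‵ 439 ⊗ (m ⊗ m)) refl m))
-- The added polynomial is the slack `39 * m * suc m - 100` at `m = 2 + t`.
halves-product {suc (suc t)} (ℕ.s≤s (ℕ.s≤s _)) (inj₂ refl) = ℕ.m+n≤o⇒m≤o _ (ℕ.≤-reflexive
  (ℕSolver.solve 1 (λ t → ‵ 100 ⊗ ((‵ 3 ⊕ t ⊕ (‵ 2 ⊕ t)) ⊗ (‵ 3 ⊕ t ⊕ (‵ 2 ⊕ t)))
                  ⊕ (‵ 134 ⊕ ‵ 195 ⊗ t ⊕ ‵ 39 ⊗ (t ⊗ t))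
                  ⊜ ‵ 439 ⊗ ((‵ 2 ⊕ t) ⊗ (‵ 3 ⊕ t))) refl t))

-- With `j = ⌈ n /2⌉` active rounds, `gainBound-after` applies after multiplying by `n * n`; `4 ≤ n`
-- provides the `2 ≤ m` for `halves-product`.
gainBound-ratio : ∀ n → 4 ℕ.≤ n → 100 ℕ.* n ! ℕ.≤ 439 ℕ.* gainBound ⌊ n /2⌋ n
gainBound-ratio n 4≤n = ℕ.*-cancelˡ-≤ (n ℕ.* n) {{ℕ.m*n≢0 n n {{n≢0}} {{n≢0}}}} (begin
  n ℕ.* n ℕ.* (100 ℕ.* n !)
    ≡⟨ ℕSolver.solve 3 (λ x c f → x ⊗ (c ⊗ f) ⊜ c ⊗ x ⊗ f) refl (n ℕ.* n) 100 (n !) ⟩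
  100 ℕ.* (n ℕ.* n) ℕ.* n !
    ≤⟨ ℕ.*-monoˡ-≤ (n !) (subst (λ i → 100 ℕ.* (i ℕ.* i) ℕ.≤ 439 ℕ.* (m ℕ.* j)) j+m≡n
         (halves-product (ℕ.⌊n/2⌋-mono 4≤n) (⌈n/2⌉-cases n))) ⟩
  439 ℕ.* (m ℕ.* j) ℕ.* n !
    ≡⟨ ℕ.*-assoc 439 (m ℕ.* j) (n !) ⟩
  439 ℕ.* (m ℕ.* j ℕ.* n !)
    ≤⟨ ℕ.*-monoʳ-≤ 439 (subst (λ i → m ℕ.* j ℕ.* i ! ℕ.≤ n ℕ.* i ℕ.* gainBound m i) j+m≡n
         (gainBound-after m j (ℕ.≤-reflexive j+m≡n))) ⟩
  439 ℕ.* (n ℕ.* n ℕ.* gainBound m n)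
    ≡⟨ ℕSolver.solve 3 (λ c x g → c ⊗ (x ⊗ g) ⊜ x ⊗ (c ⊗ g)) refl 439 (n ℕ.* n) (gainBound m n) ⟩
  n ℕ.* n ℕ.* (439 ℕ.* gainBound m n) ∎)
  where
  open ℕ.≤-Reasoning
  m j : ℕ
  m = ⌊ n /2⌋
  j = ⌈ n /2⌉
  n≢0 : ℕ.NonZero n
  n≢0 = ℕ.>-nonZero (ℕ.≤-trans (ℕ.s≤s ℕ.z≤n) 4≤n)
  j+m≡n : j ℕ.+ m ≡ n
  j+m≡n = ≡.trans (ℕ.+-comm j m) (ℕ.⌊n/2⌋+⌈n/2⌉≡n n)

-- The algorithm and its feasibility

policy : Rule
policy n W l with 0ℚ <? W
... | yes 0<W = Policy.fraction ⌊ n /2⌋ W {{positive 0<W}} (reverse l)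
-- Default value: every instance has positive capacity.
... | no  _   = 0ℚ

module _ {n} (I : Instance n) where

  private
    instance
      W⁺ : Positive (capacity I)
      W⁺ = positive (0<capacity I)

  open Policy ⌊ n /2⌋ (capacity I)
  open Greedy (capacity I)

  policy≡fraction : ∀ l → policy n (capacity I) l ≡ fraction (reverse l)
  policy≡fraction l with 0ℚ <? capacity I
  ... | yes _   = refl
  ... | no  0≮W = contradiction (0<capacity I) 0≮W

  history : Permutation′ n → List Item
  history σ = reverse (tabulate (λ ℓ → item I (σ ⟨$⟩ʳ ℓ)))

  -- Reindexing by `σ` turns items into rounds. Taking `w = size` gives feasibility, `w = profit`
  -- the earned profit.
  sum-packing : ∀ w σ → sum (λ i → w (item I i) * packing policy I σ i) ≡ total w (history σ)
  sum-packing w σ = begin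
    sum (λ i → w (item I i) * packing policy I σ i)
      ≡⟨ sum-permute (λ i → w (item I i) * packing policy I σ i) σ ⟩
    sum (λ ℓ → w (item I (σ ⟨$⟩ʳ ℓ)) * packing policy I σ (σ ⟨$⟩ʳ ℓ))
      ≡⟨ sum-cong-≗ (λ ℓ → cong (w (item I (σ ⟨$⟩ʳ ℓ)) *_) (≡.trans
           (policy≡fraction (revealed I σ (σ ⟨$⟩ˡ (σ ⟨$⟩ʳ ℓ))))
           (cong (λ ℓ → fraction (reverse (revealed I σ ℓ))) (inverseˡ σ)))) ⟩
    sum (λ ℓ → w (item I (σ ⟨$⟩ʳ ℓ)) * fraction (reverse (revealed I σ ℓ)))
      ≡⟨ +-identityʳ _ ⟨
    sum (λ ℓ → w (item I (σ ⟨$⟩ʳ ℓ)) * fraction (reverse (revealed I σ ℓ))) + 0ℚ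
      ≡⟨ sum-rounds w (λ ℓ → item I (σ ⟨$⟩ʳ ℓ)) [] ⟩
    total w (history σ) ∎
    where open ≡-Reasoning

  policy-feasible : ∀ σ → Feasible I (packing policy I σ)
  policy-feasible σ = record
    { nonNeg  = λ i → subst (0ℚ ≤_) (sym (policy≡fraction (revealed I σ (σ ⟨$⟩ˡ i))))
                  (0≤fraction (reverse (revealed I σ (σ ⟨$⟩ˡ i))))
    ; atMost1 = λ i → subst (_≤ 1ℚ) (sym (policy≡fraction (revealed I σ (σ ⟨$⟩ˡ i))))
                  (fraction≤1 (reverse (revealed I σ (σ ⟨$⟩ˡ i))))
    ; fits    = subst (_≤ capacity I) (sym (sum-packing size σ)) (total-size≤W (history σ))
    }

algorithm : OnlineAlgorithm
algorithm = record { rule = policy ; feasible = policy-feasible }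

-- Expected profit against the optimum

module _ {n} (I : Instance n) where

  private
    instance
      W⁺ : Positive (capacity I)
      W⁺ = positive (0<capacity I)

      n!≢0 : ℕ.NonZero (n !)
      n!≢0 = n ℕ.!≢0

  open Policy ⌊ n /2⌋ (capacity I)
  open Greedy (capacity I)

  expectedProfit≡ : expectedProfit algorithm I
    ≡ (+ 1 / n !) * ∑orders n (total profit) (tabulate (item I))
  expectedProfit≡ = cong ((+ 1 / n !) *_) (begin
    ∑ₗ (λ σ → totalProfit I (packing policy I σ)) (permutations n)
      ≡⟨ cong (foldr _+_ 0ℚ) (map-cong (sum-packing I profit) (permutations n)) ⟩
    ∑ₗ (λ σ → total profit (history I σ)) (permutations n)
      ≡⟨ ∑ₗ-permutations n (total profit) (item I) [] ⟩
    ∑orders n (λ l → total profit (l ++ [])) (tabulate (item I))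
      ≡⟨ ∑orders-cong (tabulate (item I)) (length-tabulate (item I))
           (λ l _ → cong (total profit) (++-identityʳ l)) ⟩
    ∑orders n (total profit) (tabulate (item I)) ∎)
    where open ≡-Reasoning

  0≤1/n! : 0ℚ ≤ + 1 / n !
  0≤1/n! = nonNegative⁻¹ (+ 1 / n !) {{normalize-nonNeg 1 (n !)}}

  0≤OPT : 0ℚ ≤ OPT I
  0≤OPT = 0≤sum (λ i → 0≤* (0≤profit (item I i)) (nonNeg (proj₁ (proj₂ (optimal-exists I))) i))

  module _ (x : Vector ℚ n) (F : Feasible I x) where

    private
      -- The analysis compares with a function on all items, so `x` is looked up by identifier and
      -- extended by `0ℚ`.
      fractionOf : Item → ℚ
      fractionOf a with any? (λ i → ident (item I i) ℕ.≟ ident a)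
      ... | yes (i , _) = x i
      ... | no  _       = 0ℚ

      fractionOf-item : ∀ i → fractionOf (item I i) ≡ x i
      fractionOf-item i with any? (λ j → ident (item I j) ℕ.≟ ident (item I i))
      ... | yes (j , eq) = cong x (ident-injective I eq)
      ... | no  ∄j       = contradiction (i , refl) ∄j

      0≤fractionOf : ∀ a → 0ℚ ≤ fractionOf a
      0≤fractionOf a with any? (λ i → ident (item I i) ℕ.≟ ident a)
      ... | yes (i , _) = nonNeg F i
      ... | no  _       = ≤-refl

      fractionOf≤1 : ∀ a → fractionOf a ≤ 1ℚ
      fractionOf≤1 a with any? (λ i → ident (item I i) ℕ.≟ ident a)
      ... | yes (i , _) = atMost1 F i
      ... | no  _       = nonNegative⁻¹ 1ℚ

      u : Item → ℚ
      u a = size a * fractionOf a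

      ∑profit : ∑ₗ (λ a → density a * u a) (tabulate (item I)) ≡ totalProfit I x
      ∑profit = ≡.trans (∑ₗ-tabulate (λ a → density a * u a) (item I)) (sum-cong-≗ λ i → begin
        density (item I i) * (size (item I i) * fractionOf (item I i))
          ≡⟨ *-assoc (density (item I i)) (size (item I i)) (fractionOf (item I i)) ⟨
        density (item I i) * size (item I i) * fractionOf (item I i)
          ≡⟨ cong₂ _*_ (sym (profit≡density*size (item I i))) (fractionOf-item i) ⟩
        profit (item I i) * x i ∎)
        where open ≡-Reasoning

      ∑size : ∑ₗ u (tabulate (item I)) ≡ totalSize I x
      ∑size = ≡.trans (∑ₗ-tabulate u (item I))
        (sum-cong-≗ (λ i → cong (size (item I i) *_) (fractionOf-item i)))

    gainBound*profit≤ : ι (gainBound ⌊ n /2⌋ n) * totalProfit I x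
                        ≤ ∑orders n (total profit) (tabulate (item I))
    gainBound*profit≤ = subst
      (λ p → ι (gainBound ⌊ n /2⌋ n) * p ≤ ∑orders n (total profit) (tabulate (item I))) ∑profit
      (gainBound≤gain u (λ a → 0≤* (0≤size a) (0≤fractionOf a))
        (λ a → ≤-trans (*-monoˡ-≤-nonNeg (size a) {{nonNegative (0≤size a)}} (fractionOf≤1 a))
                       (≤-reflexive (*-identityʳ (size a))))
        n (tabulate (item I)) (length-tabulate (item I))
        (subst Unique (sym (map-tabulate (item I) ident)) (tabulate⁺ (ident-injective I)))
        (≤-trans (≤-reflexive ∑size) (fits F)))

  expectedProfit-bound : (+ 1 / n !) * (ι (gainBound ⌊ n /2⌋ n) * OPT I) ≤ expectedProfit algorithm I
  expectedProfit-bound = ≤-trans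
    (*-monoˡ-≤-nonNeg (+ 1 / n !) {{nonNegative 0≤1/n!}}
      (gainBound*profit≤ (proj₁ (optimal-exists I)) (proj₁ (proj₂ (optimal-exists I)))))
    (≤-reflexive (sym expectedProfit≡))

  0≤expectedProfit : 0ℚ ≤ expectedProfit algorithm I
  0≤expectedProfit = ≤-trans
    (0≤* 0≤1/n! (0≤* (0≤ι (gainBound ⌊ n /2⌋ n)) 0≤OPT)) expectedProfit-bound

  expectedProfit-ratio : 4 ℕ.≤ n → (+ 100 / 439) * OPT I ≤ expectedProfit algorithm I
  expectedProfit-ratio 4≤n = begin
    q * OPT I
      ≡⟨ cong (_* OPT I) (*-identityʳ q) ⟨
    q * 1ℚ * OPT I
      -- Writing `1ℚ` as `e * ι (n !)` creates the factor `q * ι (n !)` that `gainBound-ratio`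
      -- bounds.
      ≡⟨ cong (λ o → q * o * OPT I) (/*ι 1 (n !)) ⟨
    q * (e * ι (n !)) * OPT I
      ≡⟨ solve 4 (λ q e f o → q :* (e :* f) :* o := e :* (q :* f :* o)) refl q e (ι (n !)) (OPT I) ⟩
    e * (q * ι (n !) * OPT I)
      ≤⟨ *-monoˡ-≤-nonNeg e {{nonNegative 0≤1/n!}} (*-monoʳ-≤-nonNeg (OPT I) {{nonNegative 0≤OPT}}
           (/*ι≤ι 100 439 {n !} {gainBound ⌊ n /2⌋ n} (gainBound-ratio n 4≤n))) ⟩
    e * (ι (gainBound ⌊ n /2⌋ n) * OPT I)
      ≤⟨ expectedProfit-bound ⟩
    expectedProfit algorithm I ∎
    where
    open ≤-Reasoning
    q e : ℚ
    q = + 100 / 439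
    e = + 1 / n !

-- The error term and the competitive ratio

-- Below 4 the error cancels the whole ratio, so only nonnegativity of the expected profit is left
-- to show.
error : ℕ → ℚ
error n with 4 ℕ.≤? n
... | yes _ = 0ℚ
... | no  _ = + 100 / 439

error⟶0 : error ⟶0
error⟶0 δ 0<δ = 4 , small
  where
  small : ∀ n → 4 ℕ.≤ n → ∣ error n ∣ < δ
  small n 4≤n with 4 ℕ.≤? n
  ... | yes _   = 0<δ
  ... | no  4≰n = contradiction 4≤n 4≰n

theorem1 : Σ[ A ∈ OnlineAlgorithm ] Competitive (+ 439 / 100) A
theorem1 = algorithm , error , error⟶0 , λ n _ I → bound I
  where
  -- `1/ (+ 439 / 100)` computes to `+ 100 / 439`.
  bound : ∀ {n} (I : Instance n) → (+ 100 / 439 - error n) * OPT I ≤ expectedProfit algorithm I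
  bound {n} I with 4 ℕ.≤? n
  ... | yes 4≤n = expectedProfit-ratio I 4≤n
  ... | no  _   = ≤-trans (≤-reflexive (*-zeroˡ (OPT I))) (0≤expectedProfit I)
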